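{- For any Min-$\Phi$-CSP instance $\mathcal{I}$ (with candidate lists) that is symmetric under a group of permutations of its vertices and whose multilinear relaxation has symmetry gap $\gamma$, and for any $\epsilon>0$, there is a Min-$\Phi$-CSP instance $\mathcal{I}'$ (with candidate lists) whose Basic LP has integrality gap at least $(1-\epsilon)\gamma$.
   Context: $\Phi$ is a set of cost functions $\Psi:[q]^j\to[0,1]\cup\{\infty\}$ of bounded arity. An instance has vertex set $V$, candidate lists $L_v\subseteq[q]$, and weighted hyperedges $e=(v_1,\ldots,v_j)$ (ordered tuples of distinct vertices) with cost functions $\Psi_e\in\Phi$ and weights $w_e>0$; a labeling $\ell$ with $\ell(v)\in L_v$ costs $\sum_e w_e\Psi_e(\ell(v_1),\ldots,\ell(v_j))$. The Basic LP has variables $x_{v,a}\in[0,1]$ with $\sum_a x_{v,a}=1$, $x_{v,a}=0$ for $a\notin L_v$, and $x_{e,\alpha}\in[0,1]$ ($\alpha\in[q]^{|e|}$) with $x_{v_p,a}=\sum_{\alpha:\alpha_p=a}x_{e,\alpha}$ for each $e=(v_1,\ldots,v_j)$, position $p$ and label $a$; objective $\min\sum_e w_e\sum_\alpha x_{e,\alpha}\Psi_e(\alpha)$. Its integrality gap is the ratio of the integral optimum to the Basic LP optimum. The multilinear relaxation has fractional solutions $x_{v,a}\ge0$, $\sum_a x_{v,a}=1$, $x_{v,a}=0$ for $a\notin L_v$, with value equal to the expected cost of the random labeling in which each $v$ independently receives label $a$ with probability $x_{v,a}$. An instance is symmetric under a group $\mathcal{G}$ of permutations of $V$ if every $\sigma\in\mathcal{G}$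 preserves candidate lists and maps the weighted collection of constraints onto itself; a fractional solution is symmetric if $x_{\sigma(v),a}=x_{v,a}$ for all $\sigma\in\mathcal{G}$. The symmetry gap is the ratio of the minimum value of the multilinear relaxation over symmetric fractional solutions to its minimum over all fractional solutions. -}

module Defs where

open import Level using (0ℓ) renaming (suc to lsuc)
open import Algebra.Bundles using (CommutativeRing)
import Algebra.Definitions.RawMonoid as RawMonoidDefs
open import Data.Bool.Base using (if_then_else_)
open import Data.Fin.Base using (Fin)
open import Data.Fin.Permutation as Perm using (Permutation′; _⟨$⟩ʳ_; _∘ₚ_)
import Data.Fin.Properties as Fin
open import Data.Fin.Subset using (Subset; _∈_; _∉_)
open import Data.Nat.Base as ℕ using (ℕ; zero; suc)
open import Data.Product.Base using (Σ; ∃; ∃-syntax; _×_; _,_; proj₁)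
open import Data.Vec.Base using (Vec; []; _∷_; lookup; map)
import Data.Vec.Functional as VF
open import Data.Vec.Relation.Unary.Unique.Propositional using (Unique)
open import Relation.Binary.Core using (Rel)
import Relation.Binary.Construct.NonStrictToStrict as ToStrict
open import Relation.Binary.PropositionalEquality using (_≡_)
open import Relation.Binary.Structures using (IsDecTotalOrder)
open import Relation.Nullary using (¬_; does)
open import Relation.Unary using (Pred; Decidable)

-- The real numbers, given axiomatically as a Dedekind-complete ordered field.
-- Classically this determines ℝ up to isomorphism; decidability of the order
-- and the Archimedean property are then automatic and are listed only because
-- they do not follow from the other axioms constructively.
record Reals : Set (lsuc 0ℓ) where
  infix 4 _≤_
  field
    commutativeRing : CommutativeRing 0ℓ 0ℓ

  open CommutativeRing commutativeRing public
    using (Carrier; _≈_; _+_; _*_; -_; _-_; 0#; 1#)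
  open RawMonoidDefs (CommutativeRing.+-rawMonoid commutativeRing) public
    using (sum) renaming (_×_ to _·_)

  field
    _≤_             : Rel Carrier 0ℓ
    isDecTotalOrder : IsDecTotalOrder _≈_ _≤_
    0≉1             : ¬ (0# ≈ 1#)
    inverse         : ∀ x → ¬ (x ≈ 0#) → ∃[ y ] (x * y ≈ 1#)
    +-monoˡ-≤       : ∀ z {x y} → x ≤ y → x + z ≤ y + z
    *-nonNeg        : ∀ {x y} → 0# ≤ x → 0# ≤ y → 0# ≤ x * y
    archimedean     : ∀ x → ∃[ n ] (x ≤ n · 1#)
    supremum        : (S : Pred Carrier 0ℓ) → ∃ S →
                      (∃[ u ] ∀ x → S x → x ≤ u) →
                      ∃[ s ] (∀ x → S x → x ≤ s) ×
                             (∀ u → (∀ x → S x → x ≤ u) → s ≤ u)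

  open IsDecTotalOrder isDecTotalOrder public using (_≤?_)
  open ToStrict _≈_ _≤_ public using (_<_)

record PermutationGroup (n : ℕ) : Set (lsuc 0ℓ) where
  field
    Member   : Pred (Permutation′ n) 0ℓ
    member?  : Decidable Member
    resp     : ∀ {σ τ} → σ Perm.≈ τ → Member σ → Member τ
    id∈      : Member Perm.id
    ∘∈       : ∀ {σ τ} → Member σ → Member τ → Member (σ ∘ₚ τ)
    inverse∈ : ∀ {σ} → Member σ → Member (Perm.flip σ)

-- foldWords _∙_ ε f combines f α over all words α ∈ [q]^j.
foldWords : ∀ {A : Set} (_∙_ : A → A → A) (ε : A) {q} j → (Vec (Fin q) j → A) → A
foldWords _∙_ ε zero    f = f []
foldWords _∙_ ε (suc j) f =
  VF.foldr _∙_ ε (λ a → foldWords _∙_ ε j (λ α → f (a ∷ α)))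

module Extended (R : Reals) where
  open Reals R

  infixl 6 _+∞_
  infixr 7 _⊙_
  infix  4 _≈∞_ _≤∞_

  data Ext : Set where
    fin : Carrier → Ext
    ∞   : Ext

  data _≈∞_ : Rel Ext 0ℓ where
    fin : ∀ {x y} → x ≈ y → fin x ≈∞ fin y
    top : ∞ ≈∞ ∞

  data _≤∞_ : Rel Ext 0ℓ where
    fin : ∀ {x y} → x ≤ y → fin x ≤∞ fin y
    top : ∀ {x} → x ≤∞ ∞

  _+∞_ : Ext → Ext → Ext
  fin x +∞ fin y = fin (x + y)
  fin _ +∞ ∞     = ∞
  ∞     +∞ _     = ∞

  -- 0 ⊙ ∞ is 0, as for events of probability zero.  A negative factor occurs
  -- only in the bound (1 - ε) ⊙ γ with ε > 1, where the true product -∞ and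
  -- the value 0 used here are equally trivial lower bounds for a ratio of
  -- nonnegative quantities.
  _⊙_ : Carrier → Ext → Ext
  r ⊙ fin x = fin (r * x)
  r ⊙ ∞     = if does (r ≤? 0#) then fin 0# else ∞

  sum∞ : ∀ {n} → (Fin n → Ext) → Ext
  sum∞ = VF.foldr _+∞_ (fin 0#)

  product : ∀ {n} → (Fin n → Carrier) → Carrier
  product = VF.foldr _*_ 1#

  sumWords : ∀ {q} j → (Vec (Fin q) j → Carrier) → Carrier
  sumWords = foldWords _+_ 0#

  sumWords∞ : ∀ {q} j → (Vec (Fin q) j → Ext) → Ext
  sumWords∞ = foldWords _+∞_ (fin 0#)

  IsMinimum : {A : Set} → (A → Ext) → Ext → Set
  IsMinimum f m = (∃[ a ] f a ≈∞ m) × (∀ a → m ≤∞ f a)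

  -- IsRatio a b γ means γ = a / b for nonnegative a ≥ b.  The quotients 0/0
  -- and ∞/∞ are undefined; a positive number over 0, and ∞ over a finite
  -- number, are ∞.
  data IsRatio : Ext → Ext → Ext → Set where
    finite     : ∀ {a b γ} → 0# < b → γ * b ≈ a → IsRatio (fin a) (fin b) (fin γ)
    positive/0 : ∀ {a b} → 0# < a → b ≈ 0# → IsRatio (fin a) (fin b) ∞
    ∞/finite   : ∀ {b} → IsRatio ∞ (fin b) ∞

module MinCSP (R : Reals) (q : ℕ) where
  open Reals R
  open Extended R public

  Label : Set
  Label = Fin q

  data Cost : Set where
    cost : ∀ r → 0# ≤ r → r ≤ 1# → Cost
    ∞    : Cost

  value : Cost → Ext
  value (cost r _ _) = fin r
  value ∞            = ∞

  CostFunction : ℕ → Set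
  CostFunction j = Vec Label j → Cost

  record CostFamily : Set (lsuc 0ℓ) where
    field
      Member       : ∀ {j} → Pred (CostFunction j) 0ℓ
      maxArity     : ℕ
      boundedArity : ∀ {j} {Ψ : CostFunction j} → Member Ψ → j ℕ.≤ maxArity

  module _ (Φ : CostFamily) where

    record Hyperedge (n j : ℕ) : Set where
      field
        vertices : Vec (Fin n) j
        distinct : Unique vertices
        Ψ        : CostFunction j
        Ψ∈Φ      : CostFamily.Member Φ Ψ
        weight   : Carrier
        weight>0 : 0# < weight

    record Instance : Set where
      field
        vertexCount : ℕ
        list        : Fin vertexCount → Subset q
        edgeCount   : ℕ
        arity       : Fin edgeCount → ℕ
        edge        : ∀ e → Hyperedge vertexCount (arity e)

      Vertex : Set
      Vertex = Fin vertexCount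

      Edge : Set
      Edge = Fin edgeCount

      module _ (e : Edge) where
        open Hyperedge (edge e) public

  module _ {Φ : CostFamily} where

    -- IsImage σ h h′: h′ is the constraint h with each vertex v replaced by
    -- σ v, and with the same cost function and weight.
    data IsImage {n} (σ : Permutation′ n) :
         ∀ {j k} → Hyperedge Φ n j → Hyperedge Φ n k → Set where
      image : ∀ {j} {h h′ : Hyperedge Φ n j} → let open Hyperedge in
              vertices h′ ≡ map (σ ⟨$⟩ʳ_) (vertices h) →
              (∀ α → value (Ψ h′ α) ≈∞ value (Ψ h α)) →
              weight h′ ≈ weight h →
              IsImage σ h h′

    module _ (I : Instance Φ) where
      open Instance I

      costOf : Vec Label vertexCount → Ext
      costOf ℓ = sum∞ λ e → weight e ⊙ value (Ψ e (map (lookup ℓ) (vertices e)))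

      Labeling : Set
      Labeling = Σ (Vec Label vertexCount) λ ℓ → ∀ v → lookup ℓ v ∈ list v

      record BasicLPSolution : Set where
        field
          x          : Vertex → Label → Carrier
          x≥0        : ∀ v a → 0# ≤ x v a
          x≤1        : ∀ v a → x v a ≤ 1#
          x-sum      : ∀ v → sum (x v) ≈ 1#
          x-list     : ∀ v a → a ∉ list v → x v a ≈ 0#
          y          : ∀ e → Vec Label (arity e) → Carrier
          y≥0        : ∀ e α → 0# ≤ y e α
          y≤1        : ∀ e α → y e α ≤ 1#
          y-marginal : ∀ e p a →
                       x (lookup (vertices e) p) a ≈
                       sumWords (arity e) λ α →
                         if does (lookup α p Fin.≟ a) then y e α else 0#

      lpValue : BasicLPSolution → Ext
      lpValue s = sum∞ λ e →
        weight e ⊙ sumWords∞ (arity e) λ α → y e α ⊙ value (Ψ e α)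
        where open BasicLPSolution s

      IntegralityGap : Ext → Set
      IntegralityGap ρ = ∃[ opt ] ∃[ lp ]
        IsMinimum {Labeling} (λ ℓ → costOf (proj₁ ℓ)) opt ×
        IsMinimum lpValue lp ×
        IsRatio opt lp ρ

      record FractionalSolution : Set where
        field
          x      : Vertex → Label → Carrier
          x≥0    : ∀ v a → 0# ≤ x v a
          x-sum  : ∀ v → sum (x v) ≈ 1#
          x-list : ∀ v a → a ∉ list v → x v a ≈ 0#

      multilinearValue : FractionalSolution → Ext
      multilinearValue s = sumWords∞ vertexCount λ ℓ →
        product (λ v → x v (lookup ℓ v)) ⊙ costOf ℓ
        where open FractionalSolution s

      module _ (G : PermutationGroup vertexCount) where
        open PermutationGroup G using (Member)

        IsSymmetricInstance : Set
        IsSymmetricInstance = ∀ σ → Member σ →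
          (∀ v → list (σ ⟨$⟩ʳ v) ≡ list v) ×
          (Σ (Permutation′ edgeCount) λ π →
             ∀ e → IsImage σ (edge e) (edge (π ⟨$⟩ʳ e)))

        IsSymmetricSolution : FractionalSolution → Set
        IsSymmetricSolution s = ∀ σ → Member σ → ∀ v a → x (σ ⟨$⟩ʳ v) a ≈ x v a
          where open FractionalSolution s

        SymmetryGap : Ext → Set
        SymmetryGap γ = ∃[ sym ] ∃[ opt ]
          IsMinimum {Σ FractionalSolution IsSymmetricSolution}
                    (λ s → multilinearValue (proj₁ s)) sym ×
          IsMinimum multilinearValue opt ×
          IsRatio sym opt γ

{-# OPTIONS --safe #-}
module Submission where

-- For large n, the instance I′ has n copies of every vertex of I, and every
-- injective choice of copies s : V → [n] contributes a copy of I in which v is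
-- represented by the s(v)-th copy of the representative of the orbit of v.
--
-- LP side: for an optimal labeling ℓ of I, averaging ℓ ∘ σ over σ ∈ G gives
-- local distributions whose marginals depend only on the orbit of a vertex, so
-- they fit together on I′, and by symmetry they cost as much as ℓ.
--
-- Integral side: a labeling of I′ defines a symmetric fractional solution of I
-- by its label frequencies on the copies of each representative.  Labels with
-- fewer than |V| occurrences are first replaced, so that every labeling of
-- positive probability is realised by an injective choice of copies (this
-- controls infinite costs).  Collisions and replaced labels have probability
-- O(1/n).
--
-- The Basic LP of I′ attains its minimum by Fourier–Motzkin elimination.

open import Defs
open import Algebra.Bundles using (CommutativeRing)
import Algebra.Properties.CommutativeMonoid.Sum as MonoidSum
import Algebra.Properties.Ring as RingProperties
import Algebra.Solver.Ring.NaturalCoefficients.Default as NaturalSolver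
open import Data.Bool.Base using (Bool; true; false; if_then_else_; _∧_)
open import Data.Empty using (⊥-elim)
open import Data.Fin.Base using (Fin; zero; suc; combine; remQuot)
open import Data.Fin.Permutation as Perm using (Permutation′; _⟨$⟩ʳ_; _⟨$⟩ˡ_; _∘ₚ_; permutation)
import Data.Fin.Properties as Fin
open import Data.Fin.Subset using (_∈_; _∉_)
open import Data.Fin.Subset.Properties using (_∈?_)
open import Data.List.Base as List using (List; []; _∷_; _++_; concatMap; allFin; tabulate; length; cartesianProductWith)
import Data.List.Membership.Propositional as List
import Data.List.Membership.Propositional.Properties as ∈
open import Data.List.Relation.Unary.All as All using (All; []; _∷_)
import Data.List.Relation.Unary.All.Properties as All
open import Data.List.Relation.Unary.Any as Any using (here; there; index)
import Data.List.Relation.Unary.Any.Properties as Any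
open import Data.Maybe.Base as Maybe using (Maybe; just; nothing; fromMaybe)
open import Data.Nat.Base as ℕ using (ℕ; zero; suc)
import Data.Nat.Properties as ℕ
open import Data.Product.Base using (Σ; ∃; ∃-syntax; _×_; _,_; proj₁; proj₂)
open import Data.Sum.Base using (_⊎_; inj₁; inj₂)
open import Data.Vec.Base as Vec using (Vec; []; _∷_; lookup)
import Data.Vec.Properties as Vec
import Data.Vec.Relation.Unary.All as VecAll
open import Data.Vec.Relation.Unary.All using ([]; _∷_)
open import Data.Vec.Relation.Unary.AllPairs using ([]; _∷_; allPairs?)
open import Data.Vec.Relation.Unary.Unique.Propositional using (Unique)
import Data.Vec.Relation.Unary.Unique.Propositional.Properties as Unique
open import Function.Base using (_∘_; id)
open import Function.Bundles using (mk⇔)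
open import Level using (0ℓ)
open import Relation.Binary.Bundles using (Poset)
open import Relation.Binary.PropositionalEquality as ≡ using (_≡_; _≢_; refl)
import Relation.Binary.Reasoning.PartialOrder as PosetReasoning
open import Relation.Binary.Structures using (IsDecTotalOrder)
open import Relation.Nullary using (¬_; ¬?; Dec; yes; no; does)
open import Relation.Nullary.Decidable using (_×-dec_; does-⇔; dec-true; map′)

-- The integral optimum of I links the two sides: it is at most the minimum b of the multilinear
-- relaxation, since an average is no less than its least term, and it bounds the Basic LP of I′.
-- Conversely, a labeling of I′ of cost o yields a symmetric solution of value at most o + τ, so o ≥
-- S - τ for the symmetric minimum S. This loss is additive, whereas the theorem asks for the factor
-- 1 - ε. A defined ratio S/b forces S > 0, so n can be taken so large that τ lies below both εS and
-- S; the second bound keeps the integral optimum of I′ positive and its ratio defined even when the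
-- LP value is 0.
--
-- Choices of copies are injective because a hyperedge has distinct vertices, while vertices of one
-- orbit share the copies of one representative. Independent sampling does not respect this: a label
-- that occurs once among the copies can be drawn by two vertices at once. No copy of I realises
-- such a labeling, and it may cost ∞, so that a small probability would not help.

module OrderedField (R : Reals) where
  open Reals R public renaming (sum to sumFin)
  open CommutativeRing commutativeRing public
    using ( +-cong; +-congˡ; +-congʳ; *-cong; *-congˡ; *-congʳ; -‿cong
          ; +-assoc; +-comm; +-identityˡ; +-identityʳ; *-assoc; *-comm
          ; *-identityˡ; *-identityʳ; distribˡ; distribʳ; zeroˡ; zeroʳ
          ; -‿inverseʳ; ring; commutativeSemiring )
    renaming (refl to ≈-refl; sym to ≈-sym; trans to ≈-trans; reflexive to ≈-reflexive)
  open RingProperties ring public using (-‿distribˡ-*; -‿distribʳ-*; -‿involutive; -1*x≈-x)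
  open IsDecTotalOrder isDecTotalOrder public
    using (total; antisym)
    renaming (reflexive to ≤-reflexive; refl to ≤-refl; trans to ≤-trans
             ; ≤-respˡ-≈ to ≤-respˡ; ≤-respʳ-≈ to ≤-respʳ)
  open NaturalSolver commutativeSemiring public using (solve; _:+_; _:*_; _:=_)

  ≤-poset : Poset 0ℓ 0ℓ 0ℓ
  ≤-poset = record
    { isPartialOrder = IsDecTotalOrder.isPartialOrder isDecTotalOrder }

  module ≤-Reasoning = PosetReasoning ≤-poset

  +-mono-≤ : ∀ {x y u v} → x ≤ y → u ≤ v → x + u ≤ y + v
  +-mono-≤ {x} {y} {u} {v} x≤y u≤v = begin
    x + u  ≤⟨ +-monoˡ-≤ u x≤y ⟩
    y + u  ≈⟨ +-comm y u ⟩
    u + y  ≤⟨ +-monoˡ-≤ y u≤v ⟩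
    v + y  ≈⟨ +-comm v y ⟩
    y + v  ∎
    where open ≤-Reasoning

  +-nonNeg : ∀ {x y} → 0# ≤ x → 0# ≤ y → 0# ≤ x + y
  +-nonNeg 0≤x 0≤y = ≤-respˡ (+-identityˡ 0#) (+-mono-≤ 0≤x 0≤y)

  x≤x+y : ∀ {x y} → 0# ≤ y → x ≤ x + y
  x≤x+y {x} 0≤y = ≤-respˡ (+-identityʳ x) (+-mono-≤ ≤-refl 0≤y)

  x≤y+x : ∀ {x y} → 0# ≤ y → x ≤ y + x
  x≤y+x {x} 0≤y = ≤-respˡ (+-identityˡ x) (+-mono-≤ 0≤y ≤-refl)

  x+[y-x]≈y : ∀ x y → x + (y - x) ≈ y
  x+[y-x]≈y x y = begin-equality
    x + (y - x)    ≈⟨ solve 3 (λ x y m → x :+ (y :+ m) := y :+ (x :+ m)) ≈-refl x y (- x) ⟩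
    y + (x - x)    ≈⟨ +-congˡ (-‿inverseʳ x) ⟩
    y + 0#         ≈⟨ +-identityʳ y ⟩
    y              ∎
    where open ≤-Reasoning

  ≤⇒0≤- : ∀ {x y} → x ≤ y → 0# ≤ y - x
  ≤⇒0≤- {x} x≤y = ≤-respˡ (-‿inverseʳ x) (+-monoˡ-≤ (- x) x≤y)

  0≤-⇒≤ : ∀ {x y} → 0# ≤ y - x → x ≤ y
  0≤-⇒≤ {x} {y} 0≤y-x = ≤-respʳ (x+[y-x]≈y x y) (x≤x+y 0≤y-x)

  ≤0⇒0≤- : ∀ {x} → x ≤ 0# → 0# ≤ - x
  ≤0⇒0≤- {x} x≤0 = ≤-respʳ (+-identityˡ (- x)) (≤⇒0≤- x≤0)

  *-monoʳ-≤ : ∀ {x y z} → 0# ≤ z → x ≤ y → z * x ≤ z * y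
  *-monoʳ-≤ {x} {y} {z} 0≤z x≤y = ≤-respʳ
    (≈-trans (≈-sym (distribˡ z x (y - x))) (*-congˡ (x+[y-x]≈y x y)))
    (x≤x+y (*-nonNeg 0≤z (≤⇒0≤- x≤y)))

  *-monoˡ-≤ : ∀ {x y z} → 0# ≤ z → x ≤ y → x * z ≤ y * z
  *-monoˡ-≤ {x} {y} {z} 0≤z x≤y =
    ≤-respˡ (*-comm z x) (≤-respʳ (*-comm z y) (*-monoʳ-≤ 0≤z x≤y))

  0≤1 : 0# ≤ 1#
  0≤1 with total 0# 1#
  ... | inj₁ 0≤1 = 0≤1
  -- If 1 ≤ 0, then -1 is nonnegative, and hence so is its square 1.
  ... | inj₂ 1≤0 = ≤-respʳ
    (≈-trans (-1*x≈-x (- 1#)) (-‿involutive 1#)) (*-nonNeg (≤0⇒0≤- 1≤0) (≤0⇒0≤- 1≤0))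

  0<1 : 0# < 1#
  0<1 = 0≤1 , 0≉1

  ≰⇒< : ∀ {x y} → ¬ (x ≤ y) → y < x
  ≰⇒< {x} {y} x≰y with total x y
  ... | inj₁ x≤y = ⊥-elim (x≰y x≤y)
  ... | inj₂ y≤x = y≤x , λ y≈x → x≰y (≤-reflexive (≈-sym y≈x))

  <⇒≰ : ∀ {x y} → x < y → ¬ (y ≤ x)
  <⇒≰ (x≤y , x≉y) y≤x = x≉y (antisym x≤y y≤x)

  <-≤-trans : ∀ {x y z} → x < y → y ≤ z → x < z
  <-≤-trans x<y y≤z = ≰⇒< λ z≤x → <⇒≰ x<y (≤-trans y≤z z≤x)

  ≤-<-trans : ∀ {x y z} → x ≤ y → y < z → x < z
  ≤-<-trans x≤y y<z = ≰⇒< λ z≤x → <⇒≰ y<z (≤-trans z≤x x≤y)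

  *-pos : ∀ {x y} → 0# < x → 0# < y → 0# < x * y
  *-pos {x} {y} 0<x 0<y = *-nonNeg (proj₁ 0<x) (proj₁ 0<y) , λ 0≈xy →
    let x⁻¹ , xx⁻¹≈1 = inverse x (λ x≈0 → proj₂ 0<x (≈-sym x≈0)) in
    proj₂ 0<y (begin-equality
      0#              ≈⟨ zeroʳ x⁻¹ ⟨
      x⁻¹ * 0#        ≈⟨ *-congˡ 0≈xy ⟩
      x⁻¹ * (x * y)   ≈⟨ solve 3 (λ i x y → i :* (x :* y) := (x :* i) :* y) ≈-refl x⁻¹ x y ⟩
      (x * x⁻¹) * y   ≈⟨ *-congʳ xx⁻¹≈1 ⟩
      1# * y          ≈⟨ *-identityˡ y ⟩
      y               ∎)
    where open ≤-Reasoning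

  inverse⁺ : ∀ {x} → 0# < x → ∃[ y ] (x * y ≈ 1#) × 0# < y
  inverse⁺ {x} 0<x with inverse x (λ x≈0 → proj₂ 0<x (≈-sym x≈0))
  ... | y , xy≈1 = y , xy≈1 , ≰⇒< λ y≤0 → <⇒≰ 0<1 (≤-respˡ xy≈1
    (≤-respʳ (zeroʳ x) (*-monoʳ-≤ (proj₁ 0<x) y≤0)))

  *-cancelˡ-≤ : ∀ {x y z} → 0# < z → z * x ≤ z * y → x ≤ y
  *-cancelˡ-≤ {x} {y} {z} 0<z zx≤zy with inverse⁺ 0<z
  ... | z⁻¹ , zz⁻¹≈1 , 0<z⁻¹ =
    ≤-respˡ (cancel x) (≤-respʳ (cancel y) (*-monoʳ-≤ (proj₁ 0<z⁻¹) zx≤zy))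
    where
    open ≤-Reasoning
    cancel : ∀ t → z⁻¹ * (z * t) ≈ t
    cancel t = begin-equality
      z⁻¹ * (z * t)  ≈⟨ solve 3 (λ i z t → i :* (z :* t) := (z :* i) :* t) ≈-refl z⁻¹ z t ⟩
      (z * z⁻¹) * t  ≈⟨ *-congʳ zz⁻¹≈1 ⟩
      1# * t         ≈⟨ *-identityˡ t ⟩
      t              ∎

  ·-nonNeg : ∀ n → 0# ≤ n · 1#
  ·-nonNeg zero    = ≤-refl
  ·-nonNeg (suc n) = +-nonNeg 0≤1 (·-nonNeg n)

  infix 8 [_]
  -- Iverson bracket: probabilities and counts are written below as sums of brackets, so that events
  -- are handled by algebra.
  [_] : ∀ {P : Set} → Dec P → Carrier
  [ d ] = if does d then 1# else 0#

  []-nonNeg : ∀ {P : Set} (d : Dec P) → 0# ≤ [ d ]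
  []-nonNeg (yes _) = 0≤1
  []-nonNeg (no _)  = ≤-refl

  []-≤1 : ∀ {P : Set} (d : Dec P) → [ d ] ≤ 1#
  []-≤1 (yes _) = ≤-refl
  []-≤1 (no _)  = 0≤1

  []-yes : ∀ {P : Set} (d : Dec P) → P → [ d ] ≈ 1#
  []-yes (yes _) p = ≈-refl
  []-yes (no ¬p) p = ⊥-elim (¬p p)

  []-no : ∀ {P : Set} (d : Dec P) → ¬ P → [ d ] ≈ 0#
  []-no (yes p) ¬p = ⊥-elim (¬p p)
  []-no (no _)  ¬p = ≈-refl

  []-⇔ : ∀ {P Q : Set} (d : Dec P) (e : Dec Q) → (P → Q) → (Q → P) → [ d ] ≈ [ e ]
  []-⇔ (yes p) e f g = ≈-sym ([]-yes e (f p))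
  []-⇔ (no ¬p) e f g = ≈-sym ([]-no e λ q → ¬p (g q))

  []-* : ∀ {P : Set} (d : Dec P) x → (if does d then x else 0#) ≈ [ d ] * x
  []-* (yes _) x = ≈-sym (*-identityˡ x)
  []-* (no _)  x = ≈-sym (zeroˡ x)

  []-*-cong : ∀ {P : Set} (d : Dec P) {x y} → (P → x ≈ y) → [ d ] * x ≈ [ d ] * y
  []-*-cong (yes p) x≈y = *-congˡ (x≈y p)
  []-*-cong (no _)  x≈y = ≈-trans (zeroˡ _) (≈-sym (zeroˡ _))

-- Enumerations of finite types

words : ∀ n j → List (Vec (Fin n) j)
words n zero    = [] ∷ []
words n (suc j) = concatMap (λ a → List.map (a ∷_) (words n j)) (allFin n)

infix 4 _≟ʷ_
_≟ʷ_ : ∀ {n j} (α β : Vec (Fin n) j) → Dec (α ≡ β)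
_≟ʷ_ = Vec.≡-dec Fin._≟_

-- Repetitions in `elements` are harmless: a variable is located by the one index that `complete`
-- supplies, and a repeated constraint changes no feasible set.
record Finite (A : Set) : Set where
  field
    elements : List A
    complete : ∀ a → a List.∈ elements
open Finite

finite-Fin : ∀ n → Finite (Fin n)
finite-Fin n = record { elements = allFin n ; complete = ∈.∈-allFin }

finite-Σ : ∀ {A : Set} {B : A → Set} → Finite A → (∀ a → Finite (B a)) → Finite (Σ A B)
finite-Σ 𝔸 𝔹 = record
  { elements = concatMap (λ a → List.map (a ,_) (elements (𝔹 a))) (elements 𝔸)
  ; complete = λ (a , b) → ∈.∈-concatMap⁺ _
      (List.lose (complete 𝔸 a) (∈.∈-map⁺ (a ,_) (complete (𝔹 a) b)))
  }

finite-⊎ : ∀ {A B : Set} → Finite A → Finite B → Finite (A ⊎ B)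
finite-⊎ 𝔸 𝔹 = record
  { elements = List.map inj₁ (elements 𝔸) ++ List.map inj₂ (elements 𝔹)
  ; complete = λ where
      (inj₁ a) → ∈.∈-++⁺ˡ (∈.∈-map⁺ inj₁ (complete 𝔸 a))
      (inj₂ b) → ∈.∈-++⁺ʳ _ (∈.∈-map⁺ inj₂ (complete 𝔹 b))
  }

∈-words : ∀ {n j} (α : Vec (Fin n) j) → α List.∈ words n j
∈-words []      = here refl
∈-words (a ∷ α) = ∈.∈-concatMap⁺ _ (List.lose (∈.∈-allFin a) (∈.∈-map⁺ (a ∷_) (∈-words α)))

finite-words : ∀ n j → Finite (Vec (Fin n) j)
finite-words n j = record { elements = words n j ; complete = ∈-words }

-- Finite sums, indicators and product distributions

module Sums (R : Reals) where
  open OrderedField R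
  open Extended R using (sumWords; product)
  open ≤-Reasoning

  -- Common form for the folds `sumFin` and `sumWords` of the definitions and for sums over the
  -- hyperedges of the blow-up, so that interchange of summation is proved once.
  ∑ : ∀ {A : Set} → List A → (A → Carrier) → Carrier
  ∑ []       f = 0#
  ∑ (a ∷ as) f = f a + ∑ as f

  module _ {A : Set} where

    ∑-cong : ∀ (as : List A) {f g} → (∀ a → f a ≈ g a) → ∑ as f ≈ ∑ as g
    ∑-cong []       f≈g = ≈-refl
    ∑-cong (a ∷ as) f≈g = +-cong (f≈g a) (∑-cong as f≈g)

    ∑-mono : ∀ (as : List A) {f g} → (∀ a → f a ≤ g a) → ∑ as f ≤ ∑ as g
    ∑-mono []       f≤g = ≤-refl
    ∑-mono (a ∷ as) f≤g = +-mono-≤ (f≤g a) (∑-mono as f≤g)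

    ∑-nonNeg : ∀ (as : List A) {f} → (∀ a → 0# ≤ f a) → 0# ≤ ∑ as f
    ∑-nonNeg []       0≤f = ≤-refl
    ∑-nonNeg (a ∷ as) 0≤f = +-nonNeg (0≤f a) (∑-nonNeg as 0≤f)

    ∑-zero : ∀ (as : List A) {f} → (∀ a → f a ≈ 0#) → ∑ as f ≈ 0#
    ∑-zero []       f≈0 = ≈-refl
    ∑-zero (a ∷ as) f≈0 = ≈-trans (+-cong (f≈0 a) (∑-zero as f≈0)) (+-identityˡ 0#)

    ∑-+ : ∀ (as : List A) f g → ∑ as (λ a → f a + g a) ≈ ∑ as f + ∑ as g
    ∑-+ []       f g = ≈-sym (+-identityˡ 0#)
    ∑-+ (a ∷ as) f g = ≈-trans (+-congˡ (∑-+ as f g))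
      (solve 4 (λ a b c d → (a :+ b) :+ (c :+ d) := (a :+ c) :+ (b :+ d)) ≈-refl
         (f a) (g a) (∑ as f) (∑ as g))

    ∑-*ˡ : ∀ (as : List A) c f → ∑ as (λ a → c * f a) ≈ c * ∑ as f
    ∑-*ˡ []       c f = ≈-sym (zeroʳ c)
    ∑-*ˡ (a ∷ as) c f = ≈-trans (+-congˡ (∑-*ˡ as c f)) (≈-sym (distribˡ c (f a) (∑ as f)))

    ∑-*ʳ : ∀ (as : List A) c f → ∑ as (λ a → f a * c) ≈ ∑ as f * c
    ∑-*ʳ as c f = begin-equality
      ∑ as (λ a → f a * c)  ≈⟨ ∑-cong as (λ a → *-comm (f a) c) ⟩
      ∑ as (λ a → c * f a)  ≈⟨ ∑-*ˡ as c f ⟩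
      c * ∑ as f            ≈⟨ *-comm c (∑ as f) ⟩
      ∑ as f * c            ∎

    ∑-++ : ∀ (as bs : List A) f → ∑ (as ++ bs) f ≈ ∑ as f + ∑ bs f
    ∑-++ []       bs f = ≈-sym (+-identityˡ _)
    ∑-++ (a ∷ as) bs f = ≈-trans (+-congˡ (∑-++ as bs f)) (≈-sym (+-assoc _ _ _))

    ∑-term : ∀ {as : List A} {f a} → (∀ a → 0# ≤ f a) → a List.∈ as → f a ≤ ∑ as f
    ∑-term {as = _ ∷ as} 0≤f (here refl) = x≤x+y (∑-nonNeg as 0≤f)
    ∑-term 0≤f (there a∈as) = ≤-trans (∑-term 0≤f a∈as) (x≤y+x (0≤f _))

  ∑-map : ∀ {A B : Set} (as : List A) (g : A → B) f → ∑ (List.map g as) f ≈ ∑ as (f ∘ g)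
  ∑-map []       g f = ≈-refl
  ∑-map (a ∷ as) g f = +-congˡ (∑-map as g f)

  ∑-concatMap : ∀ {A B : Set} (as : List A) (g : A → List B) f →
                ∑ (concatMap g as) f ≈ ∑ as (λ a → ∑ (g a) f)
  ∑-concatMap []       g f = ≈-refl
  ∑-concatMap (a ∷ as) g f = ≈-trans (∑-++ (g a) _ f) (+-congˡ (∑-concatMap as g f))

  ∑-Σ : ∀ {A B C : Set} (as : List A) (bs : A → List B) (h : A → B → C) f →
        ∑ (concatMap (λ a → List.map (h a) (bs a)) as) f ≈
        ∑ as (λ a → ∑ (bs a) (λ b → f (h a b)))
  ∑-Σ as bs h f = ≈-trans (∑-concatMap as _ f) (∑-cong as λ a → ∑-map (bs a) (h a) f)

  ∑-swap : ∀ {A B : Set} (as : List A) (bs : List B) (f : A → B → Carrier) →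
           ∑ as (λ a → ∑ bs (f a)) ≈ ∑ bs (λ b → ∑ as (λ a → f a b))
  ∑-swap []       bs f = ≈-sym (∑-zero bs λ _ → ≈-refl)
  ∑-swap (a ∷ as) bs f = ≈-trans (+-congˡ (∑-swap as bs f)) (≈-sym (∑-+ bs (f a) _))

  ∑-tabulate : ∀ {A : Set} {n} (g : Fin n → A) f → ∑ (tabulate g) f ≈ sumFin (f ∘ g)
  ∑-tabulate {n = zero}  g f = ≈-refl
  ∑-tabulate {n = suc n} g f = +-congˡ (∑-tabulate (g ∘ suc) f)

  sumFin≈∑ : ∀ n (f : Fin n → Carrier) → sumFin f ≈ ∑ (allFin n) f
  sumFin≈∑ n f = ≈-sym (∑-tabulate id f)

  ∑-allFin-suc : ∀ n (f : Fin (suc n) → Carrier) →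
                 ∑ (allFin (suc n)) f ≈ f zero + ∑ (allFin n) (f ∘ suc)
  ∑-allFin-suc n f = +-congˡ (≈-trans (∑-tabulate suc f) (sumFin≈∑ n (f ∘ suc)))

  ∑-const : ∀ n c → ∑ (allFin n) (λ _ → c) ≈ (n · 1#) * c
  ∑-const zero    c = ≈-sym (zeroˡ c)
  ∑-const (suc n) c = begin-equality
    ∑ (allFin (suc n)) (λ _ → c)   ≈⟨ ∑-allFin-suc n (λ _ → c) ⟩
    c + ∑ (allFin n) (λ _ → c)     ≈⟨ +-cong (≈-sym (*-identityˡ c)) (∑-const n c) ⟩
    1# * c + (n · 1#) * c          ≈⟨ distribʳ c 1# (n · 1#) ⟨
    (1# + n · 1#) * c              ∎

  ∑-words-suc : ∀ n j (f : Vec (Fin n) (suc j) → Carrier) →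
                ∑ (words n (suc j)) f ≈ ∑ (allFin n) (λ a → ∑ (words n j) (λ α → f (a ∷ α)))
  ∑-words-suc n j f = ∑-Σ (allFin n) (λ _ → words n j) _∷_ f

  sumWords≈∑ : ∀ n j (f : Vec (Fin n) j → Carrier) → sumWords j f ≈ ∑ (words n j) f
  sumWords≈∑ n zero    f = ≈-sym (+-identityʳ (f []))
  sumWords≈∑ n (suc j) f = begin-equality
    sumFin (λ a → sumWords j (λ α → f (a ∷ α)))        ≈⟨ sumFin≈∑ n _ ⟩
    ∑ (allFin n) (λ a → sumWords j (λ α → f (a ∷ α)))  ≈⟨ ∑-cong (allFin n) (λ a → sumWords≈∑ n j _) ⟩
    ∑ (allFin n) (λ a → ∑ (words n j) (λ α → f (a ∷ α))) ≈⟨ ∑-words-suc n j f ⟨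
    ∑ (words n (suc j)) f                              ∎

  ∑-lookup : ∀ {A : Set} (as : List A) f → sumFin (λ i → f (List.lookup as i)) ≈ ∑ as f
  ∑-lookup []       f = ≈-refl
  ∑-lookup (a ∷ as) f = +-congˡ (∑-lookup as f)

  ∑-δ : ∀ {n} (k : Fin n) (f : Fin n → Carrier) → ∑ (allFin n) (λ i → [ i Fin.≟ k ] * f i) ≈ f k
  ∑-δ {suc n} zero f = begin-equality
    ∑ (allFin (suc n)) (λ i → [ i Fin.≟ zero ] * f i)
      ≈⟨ ∑-allFin-suc n (λ i → [ i Fin.≟ zero ] * f i) ⟩
    1# * f zero + ∑ (allFin n) (λ i → 0# * f (suc i))
      ≈⟨ +-cong (*-identityˡ _) (∑-zero (allFin n) λ i → zeroˡ _) ⟩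
    f zero + 0#  ≈⟨ +-identityʳ _ ⟩
    f zero       ∎
  ∑-δ {suc n} (suc k) f = begin-equality
    ∑ (allFin (suc n)) (λ i → [ i Fin.≟ suc k ] * f i)
      ≈⟨ ∑-allFin-suc n (λ i → [ i Fin.≟ suc k ] * f i) ⟩
    0# * f zero + ∑ (allFin n) (λ i → [ i Fin.≟ k ] * f (suc i))
      ≈⟨ +-cong (zeroˡ _) (∑-δ k (f ∘ suc)) ⟩
    0# + f (suc k)  ≈⟨ +-identityˡ _ ⟩
    f (suc k)       ∎

  -- Equality of nonempty words is decided by a conjunction over head and tail, so this factors its
  -- indicator coordinatewise.
  []-∧ : ∀ x y → (if x ∧ y then 1# else 0#) ≈ (if x then 1# else 0#) * (if y then 1# else 0#)
  []-∧ true  y = ≈-sym (*-identityˡ _)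
  []-∧ false y = ≈-sym (zeroˡ _)

  ∑-δ-words : ∀ {n j} (β : Vec (Fin n) j) (f : Vec (Fin n) j → Carrier) → ∑ (words n j) (λ α → [ α ≟ʷ β ] * f α) ≈ f β
  ∑-δ-words []      f = ≈-trans (+-identityʳ _) (*-identityˡ _)
  ∑-δ-words {n} {suc j} (b ∷ β) f = begin-equality
    ∑ (words n (suc j)) (λ α → [ α ≟ʷ b ∷ β ] * f α)
      ≈⟨ ∑-words-suc n j (λ α → [ α ≟ʷ b ∷ β ] * f α) ⟩
    ∑ (allFin n) (λ a → ∑ (words n j) (λ α → [ a ∷ α ≟ʷ b ∷ β ] * f (a ∷ α)))
      ≈⟨ ∑-cong (allFin n) (λ a → ∑-cong (words n j) (λ α →
           ≈-trans (*-congʳ ([]-∧ (does (a Fin.≟ b)) (does (α ≟ʷ β)))) (*-assoc _ _ _))) ⟩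
    ∑ (allFin n) (λ a → ∑ (words n j) (λ α → [ a Fin.≟ b ] * ([ α ≟ʷ β ] * f (a ∷ α))))
      ≈⟨ ∑-cong (allFin n) (λ a → ∑-*ˡ (words n j) [ a Fin.≟ b ] _) ⟩
    ∑ (allFin n) (λ a → [ a Fin.≟ b ] * ∑ (words n j) (λ α → [ α ≟ʷ β ] * f (a ∷ α)))
      ≈⟨ ∑-cong (allFin n) (λ a → *-congˡ (∑-δ-words β (λ α → f (a ∷ α)))) ⟩
    ∑ (allFin n) (λ a → [ a Fin.≟ b ] * f (a ∷ β))
      ≈⟨ ∑-δ b (λ a → f (a ∷ β)) ⟩
    f (b ∷ β) ∎

  -- Both sides equal Σ_{α,β} [β = φ α] f β.
  ∑-reindex : ∀ {n j} (φ ψ : Vec (Fin n) j → Vec (Fin n) j) →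
              (∀ α → φ (ψ α) ≡ α) → (∀ α → ψ (φ α) ≡ α) → ∀ (f : Vec (Fin n) j → Carrier) →
              ∑ (words n j) (λ α → f (φ α)) ≈ ∑ (words n j) f
  ∑-reindex {n} {j} φ ψ φψ ψφ f = begin-equality
    ∑ 𝕎 (λ α → f (φ α))
      ≈⟨ ∑-cong 𝕎 (λ α → ∑-δ-words (φ α) f) ⟨
    ∑ 𝕎 (λ α → ∑ 𝕎 (λ β → [ β ≟ʷ φ α ] * f β))
      ≈⟨ ∑-swap 𝕎 𝕎 _ ⟩
    ∑ 𝕎 (λ β → ∑ 𝕎 (λ α → [ β ≟ʷ φ α ] * f β))
      ≈⟨ ∑-cong 𝕎 (λ β → ∑-cong 𝕎 (λ α → *-congʳ ([]-⇔ (β ≟ʷ φ α) (α ≟ʷ ψ β)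
           (λ β≡φα → ≡.trans (≡.sym (ψφ α)) (≡.cong ψ (≡.sym β≡φα)))
           (λ α≡ψβ → ≡.trans (≡.sym (φψ β)) (≡.cong φ (≡.sym α≡ψβ)))))) ⟩
    ∑ 𝕎 (λ β → ∑ 𝕎 (λ α → [ α ≟ʷ ψ β ] * f β))
      ≈⟨ ∑-cong 𝕎 (λ β → ∑-δ-words (ψ β) (λ _ → f β)) ⟩
    ∑ 𝕎 f ∎
    where 𝕎 = words n j

  product-zero : ∀ {n} (f : Fin n → Carrier) i → f i ≈ 0# → product f ≈ 0#
  product-zero f zero    fi≈0 = ≈-trans (*-congʳ fi≈0) (zeroˡ _)
  product-zero f (suc i) fi≈0 = ≈-trans (*-congˡ (product-zero (f ∘ suc) i fi≈0)) (zeroʳ _)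

  product-nonNeg : ∀ {n} (f : Fin n → Carrier) → (∀ i → 0# ≤ f i) → 0# ≤ product f
  product-nonNeg {zero}  f 0≤f = 0≤1
  product-nonNeg {suc n} f 0≤f = *-nonNeg (0≤f zero) (product-nonNeg (f ∘ suc) (0≤f ∘ suc))

  infixr 8 _^_
  _^_ : Carrier → ℕ → Carrier
  r ^ zero  = 1#
  r ^ suc j = r * r ^ j

  ^-pos : ∀ {r} → 0# < r → ∀ j → 0# < r ^ j
  ^-pos 0<r zero    = 0<1
  ^-pos 0<r (suc j) = *-pos 0<r (^-pos 0<r j)

  -- Sampling from the product of the frequency distributions x v amounts to
  -- choosing an independent uniform position s v in every row m v.
  ∑-product : ∀ {n q} r j (m : Fin j → Fin n → Fin q) (x : Fin j → Fin q → Carrier) →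
              (∀ v a → x v a ≈ r * ∑ (allFin n) (λ i → [ a Fin.≟ m v i ])) →
              ∀ (F : Vec (Fin q) j → Carrier) →
              ∑ (words q j) (λ ℓ → product (λ v → x v (lookup ℓ v)) * F ℓ) ≈
              r ^ j * ∑ (words n j) (λ s → F (Vec.tabulate (λ v → m v (lookup s v))))
  ∑-product r zero m x x≈ F = begin-equality
    1# * F [] + 0#       ≈⟨ +-identityʳ _ ⟩
    1# * F []            ≈⟨ *-congˡ (+-identityʳ _) ⟨
    1# * (F [] + 0#)     ∎
  ∑-product {n} {q} r (suc j) m x x≈ F = begin-equality
    ∑ (words q (suc j)) (λ ℓ → product (λ v → x v (lookup ℓ v)) * F ℓ)
      ≈⟨ ∑-words-suc q j (λ ℓ → product (λ v → x v (lookup ℓ v)) * F ℓ) ⟩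
    ∑ 𝕃 (λ a → ∑ (words q j) (λ ℓ → (x zero a * P ℓ) * F (a ∷ ℓ)))
      ≈⟨ ∑-cong 𝕃 (λ a → ∑-cong (words q j) (λ ℓ → *-assoc _ _ _)) ⟩
    ∑ 𝕃 (λ a → ∑ (words q j) (λ ℓ → x zero a * (P ℓ * F (a ∷ ℓ))))
      ≈⟨ ∑-cong 𝕃 (λ a → ∑-*ˡ (words q j) (x zero a) _) ⟩
    ∑ 𝕃 (λ a → x zero a * ∑ (words q j) (λ ℓ → P ℓ * F (a ∷ ℓ)))
      ≈⟨ ∑-cong 𝕃 (λ a → *-cong (x≈ zero a)
           (∑-product r j (m ∘ suc) (x ∘ suc) (x≈ ∘ suc) (λ ℓ → F (a ∷ ℓ)))) ⟩
    ∑ 𝕃 (λ a → (r * ∑ ℕs (λ i → [ a Fin.≟ m zero i ])) * (r ^ j * T a))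
      ≈⟨ ∑-cong 𝕃 (λ a → solve 4 (λ r c p t → (r :* c) :* (p :* t) := (r :* p) :* (c :* t))
           ≈-refl r (∑ ℕs (λ i → [ a Fin.≟ m zero i ])) (r ^ j) (T a)) ⟩
    ∑ 𝕃 (λ a → (r * r ^ j) * (∑ ℕs (λ i → [ a Fin.≟ m zero i ]) * T a))
      ≈⟨ ∑-*ˡ 𝕃 (r * r ^ j) _ ⟩
    (r * r ^ j) * ∑ 𝕃 (λ a → ∑ ℕs (λ i → [ a Fin.≟ m zero i ]) * T a)
      ≈⟨ *-congˡ (∑-cong 𝕃 (λ a → ≈-sym (∑-*ʳ ℕs (T a) _))) ⟩
    (r * r ^ j) * ∑ 𝕃 (λ a → ∑ ℕs (λ i → [ a Fin.≟ m zero i ] * T a))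
      ≈⟨ *-congˡ (∑-swap 𝕃 ℕs _) ⟩
    (r * r ^ j) * ∑ ℕs (λ i → ∑ 𝕃 (λ a → [ a Fin.≟ m zero i ] * T a))
      ≈⟨ *-congˡ (∑-cong ℕs (λ i → ∑-δ (m zero i) T)) ⟩
    (r * r ^ j) * ∑ ℕs (λ i → T (m zero i))
      ≈⟨ *-congˡ (∑-words-suc n j (λ s → F (Vec.tabulate (λ v → m v (lookup s v))))) ⟨
    (r * r ^ j) * ∑ (words n (suc j)) (λ s → F (Vec.tabulate (λ v → m v (lookup s v)))) ∎
    where
    𝕃 = allFin q
    ℕs = allFin n
    P : Vec (Fin q) j → Carrier
    P ℓ = product (λ v → x (suc v) (lookup ℓ v))
    T : Fin q → Carrier
    T a = ∑ (words n j) (λ s → F (a ∷ Vec.tabulate (λ v → m (suc v) (lookup s v))))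

  ∑-product-distribution : ∀ {q} j (x : Fin j → Fin q → Carrier) → (∀ v → sumFin (x v) ≈ 1#) →
                           ∑ (words q j) (λ ℓ → product (λ v → x v (lookup ℓ v))) ≈ 1#
  ∑-product-distribution zero x Σx≈1 = +-identityʳ 1#
  ∑-product-distribution {q} (suc j) x Σx≈1 = begin-equality
    ∑ (words q (suc j)) (λ ℓ → product (λ v → x v (lookup ℓ v)))
      ≈⟨ ∑-words-suc q j (λ ℓ → product (λ v → x v (lookup ℓ v))) ⟩
    ∑ (allFin q) (λ a → ∑ (words q j) (λ ℓ → x zero a * product (λ v → x (suc v) (lookup ℓ v))))
      ≈⟨ ∑-cong (allFin q) (λ a → ∑-*ˡ (words q j) (x zero a) _) ⟩
    ∑ (allFin q) (λ a → x zero a * ∑ (words q j) (λ ℓ → product (λ v → x (suc v) (lookup ℓ v))))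
      ≈⟨ ∑-cong (allFin q) (λ a → ≈-trans
           (*-congˡ (∑-product-distribution j (x ∘ suc) (Σx≈1 ∘ suc))) (*-identityʳ _)) ⟩
    ∑ (allFin q) (x zero)  ≈⟨ sumFin≈∑ q (x zero) ⟨
    sumFin (x zero)        ≈⟨ Σx≈1 zero ⟩
    1#                     ∎

  -- Here `r` is 1/n, and this is the total probability of j independent uniform positions.
  uniform-total : ∀ {n r} → (n · 1#) * r ≈ 1# → ∀ j → r ^ j * ∑ (words n j) (λ _ → 1#) ≈ 1#
  uniform-total nr≈1 zero    = ≈-trans (*-identityˡ _) (+-identityʳ _)
  uniform-total {n} {r} nr≈1 (suc j) = begin-equality
    (r * r ^ j) * ∑ (words n (suc j)) (λ _ → 1#)
      ≈⟨ *-congˡ (≈-trans (∑-words-suc n j (λ _ → 1#)) (∑-const n _)) ⟩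
    (r * r ^ j) * ((n · 1#) * ∑ (words n j) (λ _ → 1#))
      ≈⟨ solve 4 (λ r p n s → (r :* p) :* (n :* s) := (n :* r) :* (p :* s)) ≈-refl
           r (r ^ j) (n · 1#) (∑ (words n j) (λ _ → 1#)) ⟩
    ((n · 1#) * r) * (r ^ j * ∑ (words n j) (λ _ → 1#))
      ≈⟨ *-cong nr≈1 (uniform-total nr≈1 j) ⟩
    1# * 1#  ≈⟨ *-identityˡ 1# ⟩
    1#       ∎

-- Fourier–Motzkin elimination

module LinearProgramming (R : Reals) where
  open OrderedField R
  open ≤-Reasoning

  infixr 5 _▸_
  -- Affine forms with the coefficient of the first variable outermost, so that an elimination step
  -- strips the head; the constant term sits at the end.
  data Form : ℕ → Set where
    constant : Carrier → Form zero
    _▸_      : ∀ {k} → Carrier → Form k → Form (suc k)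

  eval : ∀ {k} → Form k → Vec Carrier k → Carrier
  eval (constant c) []      = c
  eval (a ▸ φ)      (x ∷ z) = a * x + eval φ z

  infixl 6 _⊕_
  _⊕_ : ∀ {k} → Form k → Form k → Form k
  constant c ⊕ constant d = constant (c + d)
  (a ▸ φ)    ⊕ (b ▸ ψ)    = (a + b) ▸ (φ ⊕ ψ)

  infixr 7 _⊛_
  _⊛_ : ∀ {k} → Carrier → Form k → Form k
  r ⊛ constant c = constant (r * c)
  r ⊛ (a ▸ φ)    = (r * a) ▸ (r ⊛ φ)

  const-form : ∀ k → Carrier → Form k
  const-form zero    c = constant c
  const-form (suc k) c = 0# ▸ const-form k c

  coordinate : ∀ {k} → Fin k → Form k
  coordinate zero    = 1# ▸ const-form _ 0#
  coordinate (suc i) = 0# ▸ coordinate i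

  eval-⊕ : ∀ {k} (φ ψ : Form k) z → eval (φ ⊕ ψ) z ≈ eval φ z + eval ψ z
  eval-⊕ (constant c) (constant d) []      = ≈-refl
  eval-⊕ (a ▸ φ)      (b ▸ ψ)      (x ∷ z) = ≈-trans (+-congˡ (eval-⊕ φ ψ z))
    (solve 5 (λ a b x u v → (a :+ b) :* x :+ (u :+ v) := (a :* x :+ u) :+ (b :* x :+ v))
       ≈-refl a b x (eval φ z) (eval ψ z))

  eval-⊛ : ∀ {k} r (φ : Form k) z → eval (r ⊛ φ) z ≈ r * eval φ z
  eval-⊛ r (constant c) []      = ≈-refl
  eval-⊛ r (a ▸ φ)      (x ∷ z) = ≈-trans (+-congˡ (eval-⊛ r φ z))
    (solve 4 (λ r a x u → (r :* a) :* x :+ r :* u := r :* (a :* x :+ u)) ≈-refl r a x (eval φ z))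

  eval-const : ∀ k c (z : Vec Carrier k) → eval (const-form k c) z ≈ c
  eval-const zero    c []      = ≈-refl
  eval-const (suc k) c (x ∷ z) =
    ≈-trans (+-cong (zeroˡ x) (eval-const k c z)) (+-identityˡ c)

  eval-coordinate : ∀ {k} (i : Fin k) z → eval (coordinate i) z ≈ lookup z i
  eval-coordinate zero    (x ∷ z) =
    ≈-trans (+-cong (*-identityˡ x) (eval-const _ 0# z)) (+-identityʳ x)
  eval-coordinate (suc i) (x ∷ z) =
    ≈-trans (+-cong (zeroˡ x) (eval-coordinate i z)) (+-identityˡ _)

  Satisfies : ∀ {k} → List (Form k) → Vec Carrier k → Set
  Satisfies L z = All (λ φ → 0# ≤ eval φ z) L

  data Bound (k : ℕ) : Set where
    lower upper free : Form k → Bound k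

  Holds : ∀ {k} → Bound k → Carrier → Vec Carrier k → Set
  Holds (lower ψ) x z = eval ψ z ≤ x
  Holds (upper ψ) x z = x ≤ eval ψ z
  Holds (free ψ)  x z = 0# ≤ eval ψ z

  private
    negate : ∀ {k} (φ : Form k) z → eval ((- 1#) ⊛ φ) z ≈ - eval φ z
    negate φ z = ≈-trans (eval-⊛ (- 1#) φ z) (-1*x≈-x _)

  -- Division by the absolute value of the leading coefficient isolates the first variable; the sign
  -- of that coefficient decides the kind of bound.
  toBound : ∀ {k} (φ : Form (suc k)) →
            ∃[ β ] ∀ x z → (0# ≤ eval φ (x ∷ z) → Holds β x z) × (Holds β x z → 0# ≤ eval φ (x ∷ z))
  toBound (a ▸ φ) with a ≤? 0# | 0# ≤? a
  ... | yes a≤0 | yes 0≤a = free φ , λ x z →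
    ≤-respʳ (vanish x z) , ≤-respʳ (≈-sym (vanish x z))
    where
    vanish : ∀ x z → a * x + eval φ z ≈ eval φ z
    vanish x z = ≈-trans (+-congʳ (≈-trans (*-congʳ (antisym a≤0 0≤a)) (zeroˡ x))) (+-identityˡ _)
  -- For a > 0 the constraint says x ≥ -φ/a.
  ... | no a≰0 | _ with inverse⁺ (≰⇒< a≰0)
  ...   | b , ab≈1 , 0<b = lower (b ⊛ ((- 1#) ⊛ φ)) , λ x z →
      (λ 0≤ax+φ → ≤-respˡ (≈-sym (scaled z)) (0≤-⇒≤ (≤-respʳ (key x z) (*-nonNeg (proj₁ 0<b) 0≤ax+φ)))) ,
      (λ ψ≤x → *-cancelˡ-≤ 0<b (≤-respˡ (≈-sym (zeroʳ b))
         (≤-respʳ (≈-sym (key x z)) (≤⇒0≤- (≤-respˡ (scaled z) ψ≤x)))))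
    where
    scaled : ∀ z → eval (b ⊛ ((- 1#) ⊛ φ)) z ≈ - (b * eval φ z)
    scaled z = ≈-trans (eval-⊛ b ((- 1#) ⊛ φ) z) (≈-trans (*-congˡ (negate φ z)) (≈-sym (-‿distribʳ-* b _)))
    key : ∀ x z → b * (a * x + eval φ z) ≈ x - (- (b * eval φ z))
    key x z = begin-equality
      b * (a * x + eval φ z)
        ≈⟨ solve 4 (λ a b x u → b :* (a :* x :+ u) := (a :* b) :* x :+ b :* u) ≈-refl a b x (eval φ z) ⟩
      (a * b) * x + b * eval φ z    ≈⟨ +-cong (≈-trans (*-congʳ ab≈1) (*-identityˡ x)) (≈-sym (-‿involutive _)) ⟩
      x - (- (b * eval φ z))        ∎
  -- For a < 0 it says x ≤ φ/(-a), so the inverse of -a is the one to take.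
  toBound (a ▸ φ) | yes a≤0 | no 0≰a with inverse⁺ {x = - a} (<-neg (≰⇒< 0≰a))
    where
    <-neg : ∀ {x} → x < 0# → 0# < - x
    <-neg {x} x<0 = ≰⇒< λ -x≤0 → <⇒≰ x<0 (≤-respʳ (-‿involutive x) (≤0⇒0≤- -x≤0))
  ... | b , -ab≈1 , 0<b = upper (b ⊛ φ) , λ x z →
      (λ 0≤ax+φ → ≤-respʳ (≈-sym (eval-⊛ b φ z)) (0≤-⇒≤ (≤-respʳ (key x z) (*-nonNeg (proj₁ 0<b) 0≤ax+φ)))) ,
      (λ x≤ψ → *-cancelˡ-≤ 0<b (≤-respˡ (≈-sym (zeroʳ b))
         (≤-respʳ (≈-sym (key x z)) (≤⇒0≤- (≤-respʳ (eval-⊛ b φ z) x≤ψ)))))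
    where
    key : ∀ x z → b * (a * x + eval φ z) ≈ b * eval φ z - x
    key x z = begin-equality
      b * (a * x + eval φ z)
        ≈⟨ solve 4 (λ a b x u → b :* (a :* x :+ u) := b :* u :+ (a :* b) :* x) ≈-refl a b x (eval φ z) ⟩
      b * eval φ z + (a * b) * x
        ≈⟨ +-congˡ (begin-equality
             (a * b) * x          ≈⟨ *-congʳ (-‿involutive (a * b)) ⟨
             (- - (a * b)) * x    ≈⟨ *-congʳ (-‿cong (-‿distribˡ-* a b)) ⟩
             (- ((- a) * b)) * x  ≈⟨ *-congʳ (-‿cong -ab≈1) ⟩
             (- 1#) * x           ≈⟨ -1*x≈-x x ⟩
             - x                  ∎) ⟩
      b * eval φ z - x  ∎

  lowers uppers frees : ∀ {k} → List (Form (suc k)) → List (Form k)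
  lowers [] = []
  lowers (φ ∷ L) with proj₁ (toBound φ)
  ... | lower ψ = ψ ∷ lowers L
  ... | upper ψ = lowers L
  ... | free ψ  = lowers L
  uppers [] = []
  uppers (φ ∷ L) with proj₁ (toBound φ)
  ... | lower ψ = uppers L
  ... | upper ψ = ψ ∷ uppers L
  ... | free ψ  = uppers L
  frees [] = []
  frees (φ ∷ L) with proj₁ (toBound φ)
  ... | lower ψ = frees L
  ... | upper ψ = frees L
  ... | free ψ  = ψ ∷ frees L

  Bounds : ∀ {k} → List (Form (suc k)) → Carrier → Vec Carrier k → Set
  Bounds L x z = All (λ ψ → eval ψ z ≤ x) (lowers L) ×
                 All (λ ψ → x ≤ eval ψ z) (uppers L) ×
                 All (λ ψ → 0# ≤ eval ψ z) (frees L)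

  toBounds : ∀ {k} (L : List (Form (suc k))) {x z} → Satisfies L (x ∷ z) → Bounds L x z
  toBounds [] [] = [] , [] , []
  toBounds (φ ∷ L) {x} {z} (p ∷ ps) with toBounds L ps | toBound φ
  ... | ls , us , fs | lower ψ , eqv = proj₁ (eqv x z) p ∷ ls , us , fs
  ... | ls , us , fs | upper ψ , eqv = ls , proj₁ (eqv x z) p ∷ us , fs
  ... | ls , us , fs | free ψ  , eqv = ls , us , proj₁ (eqv x z) p ∷ fs

  fromBounds : ∀ {k} (L : List (Form (suc k))) {x z} → Bounds L x z → Satisfies L (x ∷ z)
  fromBounds [] _ = []
  fromBounds (φ ∷ L) {x} {z} (ls , us , fs) with toBound φ
  fromBounds (φ ∷ L) {x} {z} (l ∷ ls , us , fs) | lower ψ , eqv = proj₂ (eqv x z) l ∷ fromBounds L (ls , us , fs)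
  fromBounds (φ ∷ L) {x} {z} (ls , u ∷ us , fs) | upper ψ , eqv = proj₂ (eqv x z) u ∷ fromBounds L (ls , us , fs)
  fromBounds (φ ∷ L) {x} {z} (ls , us , f ∷ fs) | free ψ , eqv  = proj₂ (eqv x z) f ∷ fromBounds L (ls , us , fs)

  module _ {A : Set} (f : A → Carrier) where

    largest : ∀ a as → ∃[ b ] (b List.∈ a ∷ as) × All (λ c → f c ≤ f b) (a ∷ as)
    largest a [] = a , here refl , ≤-refl ∷ []
    largest a (a′ ∷ as) with largest a′ as
    ... | b , b∈ , ps with f a ≤? f b
    ...   | yes fa≤fb = b , there b∈ , fa≤fb ∷ ps
    ...   | no  fa≰fb = a , here refl ,
      ≤-refl ∷ All.map (λ c≤b → ≤-trans c≤b (proj₁ (≰⇒< fa≰fb))) ps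

    -- The threshold t lets a caller without lower bounds push the point as far down as it likes.
    below : ∀ t as → ∃[ x ] x ≤ t × All (λ a → x ≤ f a) as
    below t [] = t , ≤-refl , []
    below t (a ∷ as) with below t as
    ... | x , x≤t , ps with x ≤? f a
    ...   | yes x≤fa = x , x≤t , x≤fa ∷ ps
    ...   | no  x≰fa = f a , ≤-trans fa≤x x≤t , ≤-refl ∷ All.map (≤-trans fa≤x) ps
      where fa≤x = proj₁ (≰⇒< x≰fa)

  -- The largest lower bound serves, if there is one; otherwise any point below all upper bounds
  -- does.
  between : ∀ {k} (ls us : List (Form k)) z →
            (∀ {l u} → l List.∈ ls → u List.∈ us → eval l z ≤ eval u z) →
            ∃[ x ] All (λ l → eval l z ≤ x) ls × All (λ u → x ≤ eval u z) us
  between []       us z l≤u with below (λ u → eval u z) 0# us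
  ... | x , _ , x≤us = x , [] , x≤us
  between (l ∷ ls) us z l≤u with largest (λ l → eval l z) l ls
  ... | m , m∈ , ls≤m = eval m z , ls≤m , All.tabulate (λ u∈ → l≤u m∈ u∈)

  gap : ∀ {k} → Form k → Form k → Form k
  gap l u = u ⊕ ((- 1#) ⊛ l)

  eval-gap : ∀ {k} (l u : Form k) z → eval (gap l u) z ≈ eval u z - eval l z
  eval-gap l u z = ≈-trans (eval-⊕ u _ z) (+-congˡ (negate l z))

  -- Every lower bound is compared with every upper bound, which is exactly what `between` needs to
  -- recover the eliminated variable.
  eliminate : ∀ {k} → List (Form (suc k)) → List (Form k)
  eliminate L = cartesianProductWith gap (lowers L) (uppers L) ++ frees L

  eliminate-sound : ∀ {k} (L : List (Form (suc k))) {x z} →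
                    Satisfies L (x ∷ z) → Satisfies (eliminate L) z
  eliminate-sound L {x} {z} sat with toBounds L sat
  ... | ls , us , fs = All.++⁺ (All.tabulate gaps) fs
    where
    gaps : ∀ {φ} → φ List.∈ cartesianProductWith gap (lowers L) (uppers L) → 0# ≤ eval φ z
    gaps φ∈ with ∈.∈-cartesianProductWith⁻ gap (lowers L) (uppers L) φ∈
    ... | l , u , l∈ , u∈ , refl = ≤-respʳ (≈-sym (eval-gap l u z))
      (≤⇒0≤- (≤-trans (All.lookup ls l∈) (All.lookup us u∈)))

  eliminate-complete : ∀ {k} (L : List (Form (suc k))) {z} →
                       Satisfies (eliminate L) z → ∃[ x ] Satisfies L (x ∷ z)
  eliminate-complete L {z} sat with All.++⁻ (cartesianProductWith gap (lowers L) (uppers L)) sat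
  ... | gaps , fs with between (lowers L) (uppers L) z (λ {l} {u} l∈ u∈ →
          0≤-⇒≤ (≤-respʳ (eval-gap l u z)
            (All.lookup gaps (∈.∈-cartesianProductWith⁺ gap l∈ u∈))))
  ...   | x , ls , us = x , fromBounds L (ls , us , fs)

  -- The one variable that survives is the last, because elimination removes the head; `minimise`
  -- stores the objective value there.
  project : ∀ k → List (Form (k ℕ.+ 1)) → List (Form 1)
  project zero    L = L
  project (suc k) L = project k (eliminate L)

  project-sound : ∀ k (L : List (Form (k ℕ.+ 1))) (z : Vec Carrier k) {t} →
                  Satisfies L (z Vec.++ t) → Satisfies (project k L) t
  project-sound zero    L []      sat = sat
  project-sound (suc k) L (x ∷ z) sat = project-sound k (eliminate L) z (eliminate-sound L sat)

  project-complete : ∀ k (L : List (Form (k ℕ.+ 1))) {t} →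
                     Satisfies (project k L) t → ∃[ z ] Satisfies L (z Vec.++ t)
  project-complete zero    L sat = [] , sat
  project-complete (suc k) L sat with project-complete k (eliminate L) sat
  ... | z , sat′ with eliminate-complete L sat′
  ...   | x , sat″ = (x ∷ z) , sat″

  -- A solvable system in one variable that is bounded below must contain a lower bound, and the
  -- largest of these is itself a solution.
  least-solution : (L : List (Form 1)) (b : Carrier) →
                   (∀ t → Satisfies L (t ∷ []) → b ≤ t) →
                   ∀ t → Satisfies L (t ∷ []) →
                   ∃[ m ] Satisfies L (m ∷ []) × (∀ t → Satisfies L (t ∷ []) → m ≤ t)
  least-solution L b b≤ t sat with lowers L in eq | toBounds L sat
  -- Without lower bounds there would be a solution at or below b - 1.
  ... | [] | _ , us , fs = ⊥-elim (<⇒≰ b-1<b (≤-trans (b≤ x (fromBounds L (ls , x≤us , fs))) x≤b-1))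
    where
    b-1<b : b - 1# < b
    b-1<b = ≰⇒< λ b≤b-1 → <⇒≰ 0<1 (begin
      1#                         ≈⟨ x+[y-x]≈y b 1# ⟨
      b + (1# - b)               ≤⟨ +-monoˡ-≤ (1# - b) b≤b-1 ⟩
      (b - 1#) + (1# - b)        ≈⟨ solve 4 (λ b o m n → (b :+ m) :+ (o :+ n) := (b :+ n) :+ (o :+ m))
                                      ≈-refl b 1# (- 1#) (- b) ⟩
      (b - b) + (1# - 1#)        ≈⟨ +-cong (-‿inverseʳ b) (-‿inverseʳ 1#) ⟩
      0# + 0#                    ≈⟨ +-identityˡ 0# ⟩
      0#                         ∎)
    lower-bound = below (λ u → eval u []) (b - 1#) (uppers L)
    x     = proj₁ lower-bound
    x≤b-1 = proj₁ (proj₂ lower-bound)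
    x≤us  = proj₂ (proj₂ lower-bound)
    ls : All (λ l → eval l [] ≤ x) (lowers L)
    ls rewrite eq = []
  ... | l ∷ rest | ls , us , fs with largest (λ l → eval l []) l rest
  -- This point respects the upper bounds because it lies below the given solution t.
  ...   | m , m∈ , ls≤m = eval m [] ,
      fromBounds L ( ≡.subst (All (λ l → eval l [] ≤ eval m [])) (≡.sym eq) ls≤m
                   , All.map (≤-trans (All.lookup ls m∈)) us , fs) ,
      λ t′ sat′ → All.lookup (proj₁ (toBounds L sat′)) (≡.subst (m List.∈_) (≡.sym eq) m∈)

  snoc : ∀ {k} → Form k → Carrier → Form (k ℕ.+ 1)
  snoc (constant c) r = r ▸ constant c
  snoc (a ▸ φ)      r = a ▸ snoc φ r

  eval-snoc : ∀ {k} (φ : Form k) r z t → eval (snoc φ r) (z Vec.++ t ∷ []) ≈ r * t + eval φ z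
  eval-snoc (constant c) r []      t = ≈-refl
  eval-snoc (a ▸ φ)      r (x ∷ z) t = ≈-trans (+-congˡ (eval-snoc φ r z t))
    (solve 3 (λ u v w → u :+ (v :+ w) := v :+ (u :+ w)) ≈-refl (a * x) (r * t) (eval φ z))

  -- Add a last variable t with `obj` ≤ t and eliminate all the others: the least remaining t is the
  -- optimal value, and back substitution produces a point that attains it.
  minimise : ∀ {k} (L : List (Form k)) (obj : Form k) b →
             (∀ z → Satisfies L z → b ≤ eval obj z) →
             ∀ z₀ → Satisfies L z₀ →
             ∃[ z ] Satisfies L z × (∀ z′ → Satisfies L z′ → eval obj z ≤ eval obj z′)
  minimise {k} L obj b b≤ z₀ sat₀ = z , restrict z sat-m , λ z′ sat′ →
    ≤-trans (value z sat-m) (m≤ _ (project-sound k L⁺ z′ (extend z′ sat′ ≤-refl)))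
    where
    L⁺ : List (Form (k ℕ.+ 1))
    L⁺ = snoc ((- 1#) ⊛ obj) 1# ∷ List.map (λ φ → snoc φ 0#) L

    objective-eval : ∀ z t → eval (snoc ((- 1#) ⊛ obj) 1#) (z Vec.++ t ∷ []) ≈ t - eval obj z
    objective-eval z t = ≈-trans (eval-snoc ((- 1#) ⊛ obj) 1# z t) (+-cong (*-identityˡ t) (negate obj z))

    constraint-eval : ∀ φ z t → eval (snoc φ 0#) (z Vec.++ t ∷ []) ≈ eval φ z
    constraint-eval φ z t =
      ≈-trans (eval-snoc φ 0# z t) (≈-trans (+-congʳ (zeroˡ t)) (+-identityˡ _))

    extend : ∀ z {t} → Satisfies L z → eval obj z ≤ t → Satisfies L⁺ (z Vec.++ t ∷ [])
    extend z {t} sat obj≤t = ≤-respʳ (≈-sym (objective-eval z t)) (≤⇒0≤- obj≤t) ∷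
      All.map⁺ (All.map (λ {φ} → ≤-respʳ (≈-sym (constraint-eval φ z t))) sat)

    restrict : ∀ z {t} → Satisfies L⁺ (z Vec.++ t ∷ []) → Satisfies L z
    restrict z {t} (_ ∷ sat) = All.map (λ {φ} → ≤-respʳ (constraint-eval φ z t)) (All.map⁻ sat)

    value : ∀ z {t} → Satisfies L⁺ (z Vec.++ t ∷ []) → eval obj z ≤ t
    value z {t} (p ∷ _) = 0≤-⇒≤ (≤-respʳ (objective-eval z t) p)

    least = least-solution (project k L⁺) b
      (λ t sat → let z , sat⁺ = project-complete k L⁺ sat in
                 ≤-trans (b≤ z (restrict z sat⁺)) (value z sat⁺))
      (eval obj z₀) (project-sound k L⁺ z₀ (extend z₀ sat₀ ≤-refl))
    m≤ = proj₂ (proj₂ least)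
    z = proj₁ (project-complete k L⁺ (proj₁ (proj₂ least)))
    sat-m = proj₂ (project-complete k L⁺ (proj₁ (proj₂ least)))

  infixl 6 _⊞_
  infixr 7 _⊡_
  -- Affine expressions over named variables: the Basic LP has variables of two dependent kinds, and
  -- naming them keeps coordinate arithmetic out of its constraints.
  data Expr (X : Set) : Set where
    var : X → Expr X
    con : Carrier → Expr X
    _⊞_ : Expr X → Expr X → Expr X
    _⊡_ : Carrier → Expr X → Expr X

  module _ {X : Set} where

    ⟦_⟧ : Expr X → (X → Carrier) → Carrier
    ⟦ var u ⟧   f = f u
    ⟦ con c ⟧   f = c
    ⟦ φ ⊞ ψ ⟧   f = ⟦ φ ⟧ f + ⟦ ψ ⟧ f
    ⟦ r ⊡ φ ⟧   f = r * ⟦ φ ⟧ f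

    ∑ᵉ : ∀ {A : Set} → List A → (A → Expr X) → Expr X
    ∑ᵉ []       φ = con 0#
    ∑ᵉ (a ∷ as) φ = φ a ⊞ ∑ᵉ as φ

    open Sums R using (∑)

    ⟦∑ᵉ⟧ : ∀ {A : Set} (as : List A) φ f → ⟦ ∑ᵉ as φ ⟧ f ≡ ∑ as (λ a → ⟦ φ a ⟧ f)
    ⟦∑ᵉ⟧ []       φ f = refl
    ⟦∑ᵉ⟧ (a ∷ as) φ f = ≡.cong (⟦ φ a ⟧ f +_) (⟦∑ᵉ⟧ as φ f)

  minimiseExpr : ∀ {X K : Set} → Finite X → Finite K →
                 (constraint : K → Expr X) (objective : Expr X) (b : Carrier) →
                 let Feasible f = ∀ k → 0# ≤ ⟦ constraint k ⟧ f in
                 (∀ f → Feasible f → b ≤ ⟦ objective ⟧ f) →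
                 ∀ f₀ → Feasible f₀ →
                 ∃[ f ] Feasible f × (∀ f′ → Feasible f′ → ⟦ objective ⟧ f ≤ ⟦ objective ⟧ f′)
  minimiseExpr {X} {K} 𝕏 𝕂 constraint objective b b≤ f₀ feas₀ =
    decode z , decode-feasible z sat , λ f′ feas′ →
      ≤-respˡ (compile-decode objective z)
        (≤-respʳ (compile-encode objective f′) (z-min (encode f′) (encode-feasible f′ feas′)))
    where
    xs = Finite.elements 𝕏

    position : X → Fin (length xs)
    position u = index (Finite.complete 𝕏 u)

    compile : Expr X → Form (length xs)
    compile (var u) = coordinate (position u)
    compile (con c) = const-form _ c
    compile (φ ⊞ ψ) = compile φ ⊕ compile ψ
    compile (r ⊡ φ) = r ⊛ compile φ

    decode : Vec Carrier (length xs) → X → Carrier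
    decode z u = lookup z (position u)

    compile-decode : ∀ φ z → eval (compile φ) z ≈ ⟦ φ ⟧ (decode z)
    compile-decode (var u) z = eval-coordinate (position u) z
    compile-decode (con c) z = eval-const _ c z
    compile-decode (φ ⊞ ψ) z =
      ≈-trans (eval-⊕ (compile φ) _ z) (+-cong (compile-decode φ z) (compile-decode ψ z))
    compile-decode (r ⊡ φ) z = ≈-trans (eval-⊛ r (compile φ) z) (*-congˡ (compile-decode φ z))

    encode : (X → Carrier) → Vec Carrier (length xs)
    encode f = Vec.tabulate (f ∘ List.lookup xs)

    decode-encode : ∀ f u → decode (encode f) u ≡ f u
    decode-encode f u = ≡.trans (Vec.lookup∘tabulate (f ∘ List.lookup xs) (position u))
      (≡.cong f (≡.sym (Any.lookup-index (Finite.complete 𝕏 u))))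

    ⟦⟧-cong : ∀ φ {f g : X → Carrier} → (∀ u → f u ≡ g u) → ⟦ φ ⟧ f ≈ ⟦ φ ⟧ g
    ⟦⟧-cong (var u) f≡g = ≈-reflexive (f≡g u)
    ⟦⟧-cong (con c) f≡g = ≈-refl
    ⟦⟧-cong (φ ⊞ ψ) f≡g = +-cong (⟦⟧-cong φ f≡g) (⟦⟧-cong ψ f≡g)
    ⟦⟧-cong (r ⊡ φ) f≡g = *-congˡ (⟦⟧-cong φ f≡g)

    compile-encode : ∀ φ f → eval (compile φ) (encode f) ≈ ⟦ φ ⟧ f
    compile-encode φ f = ≈-trans (compile-decode φ (encode f)) (⟦⟧-cong φ (decode-encode f))

    L = List.map (compile ∘ constraint) (Finite.elements 𝕂)

    encode-feasible : ∀ f → (∀ k → 0# ≤ ⟦ constraint k ⟧ f) → Satisfies L (encode f)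
    encode-feasible f feas = All.map⁺ (All.universal
      (λ k → ≤-respʳ (≈-sym (compile-encode (constraint k) f)) (feas k)) _)

    decode-feasible : ∀ z → Satisfies L z → ∀ k → 0# ≤ ⟦ constraint k ⟧ (decode z)
    decode-feasible z sat k = ≤-respʳ (compile-decode (constraint k) z)
      (All.lookup sat (∈.∈-map⁺ (compile ∘ constraint) (Finite.complete 𝕂 k)))

    optimum = minimise L (compile objective) b
      (λ z sat → ≤-respʳ (≈-sym (compile-decode objective z)) (b≤ (decode z) (decode-feasible z sat)))
      (encode f₀) (encode-feasible f₀ feas₀)
    z     = proj₁ optimum
    sat   = proj₁ (proj₂ optimum)
    z-min = proj₂ (proj₂ optimum)

-- Extended reals and their real parts

module ExtendedProperties (R : Reals) where
  open OrderedField R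
  open Extended R
  open Sums R

  data IsFinite : Ext → Set where
    fin : ∀ r → IsFinite (fin r)

  -- The value 0 at ∞ fits the convention that 0 ⊙ ∞ is 0: `real-⊙` then holds for every factor and
  -- every argument.
  real : Ext → Carrier
  real (fin r) = r
  real ∞       = 0#

  isFinite? : ∀ x → Dec (IsFinite x)
  isFinite? (fin r) = yes (fin r)
  isFinite? ∞       = no λ ()

  fin-real : ∀ {x} → IsFinite x → x ≡ fin (real x)
  fin-real (fin r) = refl

  finite-+ : ∀ {x y} → IsFinite x → IsFinite y → IsFinite (x +∞ y)
  finite-+ (fin r) (fin t) = fin (r + t)

  finite-+⁻ : ∀ x y → IsFinite (x +∞ y) → IsFinite x × IsFinite y
  finite-+⁻ (fin r) (fin t) _ = fin r , fin t

  finite-sum : ∀ {n} (f : Fin n → Ext) → (∀ i → IsFinite (f i)) → IsFinite (sum∞ f)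
  finite-sum {zero}  f fs = fin 0#
  finite-sum {suc n} f fs = finite-+ (fs zero) (finite-sum (f ∘ suc) (fs ∘ suc))

  finite-sum⁻ : ∀ {n} (f : Fin n → Ext) → IsFinite (sum∞ f) → ∀ i → IsFinite (f i)
  finite-sum⁻ f fs zero    = proj₁ (finite-+⁻ (f zero) (sum∞ (f ∘ suc)) fs)
  finite-sum⁻ f fs (suc i) =
    finite-sum⁻ (f ∘ suc) (proj₂ (finite-+⁻ (f zero) (sum∞ (f ∘ suc)) fs)) i

  finite-sumWords : ∀ {q} j (f : Vec (Fin q) j → Ext) →
                    (∀ α → IsFinite (f α)) → IsFinite (sumWords∞ j f)
  finite-sumWords zero    f fs = fs []
  finite-sumWords (suc j) f fs =
    finite-sum (λ a → sumWords∞ j (λ α → f (a ∷ α))) λ a → finite-sumWords j _ λ α → fs (a ∷ α)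

  finite-sumWords⁻ : ∀ {q} j (f : Vec (Fin q) j → Ext) →
                     IsFinite (sumWords∞ j f) → ∀ α → IsFinite (f α)
  finite-sumWords⁻ zero    f fs []      = fs
  finite-sumWords⁻ (suc j) f fs (a ∷ α) = finite-sumWords⁻ j (λ α → f (a ∷ α))
    (finite-sum⁻ (λ a → sumWords∞ j (λ α → f (a ∷ α))) fs a) α

  real-+ : ∀ {x y} → IsFinite x → IsFinite y → real (x +∞ y) ≈ real x + real y
  real-+ (fin r) (fin t) = ≈-refl

  real-sum : ∀ {n} (f : Fin n → Ext) → (∀ i → IsFinite (f i)) →
             real (sum∞ f) ≈ sumFin (real ∘ f)
  real-sum {zero}  f fs = ≈-refl
  real-sum {suc n} f fs = ≈-trans (real-+ (fs zero) (finite-sum (f ∘ suc) (fs ∘ suc)))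
    (+-congˡ (real-sum (f ∘ suc) (fs ∘ suc)))

  real-sumWords : ∀ {q} j (f : Vec (Fin q) j → Ext) → (∀ α → IsFinite (f α)) →
                  real (sumWords∞ j f) ≈ ∑ (words q j) (real ∘ f)
  real-sumWords zero    f fs = ≈-sym (+-identityʳ _)
  real-sumWords {q} (suc j) f fs = begin-equality
    real (sum∞ (λ a → sumWords∞ j (λ α → f (a ∷ α))))
      ≈⟨ real-sum (λ a → sumWords∞ j (λ α → f (a ∷ α)))
           (λ a → finite-sumWords j _ λ α → fs (a ∷ α)) ⟩
    sumFin (λ a → real (sumWords∞ j (λ α → f (a ∷ α))))
      ≈⟨ sumFin≈∑ q _ ⟩
    ∑ (allFin q) (λ a → real (sumWords∞ j (λ α → f (a ∷ α))))
      ≈⟨ ∑-cong (allFin q) (λ a → real-sumWords j _ λ α → fs (a ∷ α)) ⟩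
    ∑ (allFin q) (λ a → ∑ (words q j) (λ α → real (f (a ∷ α))))
      ≈⟨ ∑-words-suc q j (real ∘ f) ⟨
    ∑ (words q (suc j)) (real ∘ f) ∎
    where open ≤-Reasoning

  finite-⊙ : ∀ r {x} → IsFinite x → IsFinite (r ⊙ x)
  finite-⊙ r (fin x) = fin (r * x)

  finite-⊙-≤0 : ∀ {r} → r ≤ 0# → ∀ x → IsFinite (r ⊙ x)
  finite-⊙-≤0 {r} r≤0 (fin x) = fin (r * x)
  finite-⊙-≤0 {r} r≤0 ∞ with r ≤? 0#
  ... | yes _  = fin 0#
  ... | no r≰0 = ⊥-elim (r≰0 r≤0)

  finite-⊙⁻ : ∀ r x → IsFinite (r ⊙ x) → r ≤ 0# ⊎ IsFinite x
  finite-⊙⁻ r (fin x) _ = inj₂ (fin x)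
  finite-⊙⁻ r ∞ fs with r ≤? 0#
  ... | yes r≤0 = inj₁ r≤0

  finite-⊙⁻-pos : ∀ {r} x → 0# < r → IsFinite (r ⊙ x) → IsFinite x
  finite-⊙⁻-pos {r} x 0<r fs with finite-⊙⁻ r x fs
  ... | inj₁ r≤0 = ⊥-elim (<⇒≰ 0<r r≤0)
  ... | inj₂ fx  = fx

  real-⊙ : ∀ r x → real (r ⊙ x) ≈ r * real x
  real-⊙ r (fin x) = ≈-refl
  real-⊙ r ∞ with r ≤? 0#
  ... | yes _ = ≈-sym (zeroʳ r)
  ... | no _  = ≈-sym (zeroʳ r)

  fin≤∞⁻ : ∀ {r t} → fin r ≤∞ fin t → r ≤ t
  fin≤∞⁻ (fin r≤t) = r≤t

  ≤∞-real : ∀ {r x} → (IsFinite x → r ≤ real x) → fin r ≤∞ x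
  ≤∞-real {x = fin t} r≤ = fin (r≤ (fin t))
  ≤∞-real {x = ∞}     r≤ = top

  ≤∞-total : ∀ x y → x ≤∞ y ⊎ y ≤∞ x
  ≤∞-total ∞       y       = inj₂ top
  ≤∞-total x       ∞       = inj₁ top
  ≤∞-total (fin x) (fin y) with total x y
  ... | inj₁ x≤y = inj₁ (fin x≤y)
  ... | inj₂ y≤x = inj₂ (fin y≤x)

  ≤∞-refl : ∀ {x} → x ≤∞ x
  ≤∞-refl {fin x} = fin ≤-refl
  ≤∞-refl {∞}     = top

  ≤∞-trans : ∀ {x y z} → x ≤∞ y → y ≤∞ z → x ≤∞ z
  ≤∞-trans (fin x≤y) (fin y≤z) = fin (≤-trans x≤y y≤z)
  ≤∞-trans x≤y       top       = top

  ≈∞-refl : ∀ {x} → x ≈∞ x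
  ≈∞-refl {fin x} = fin ≈-refl
  ≈∞-refl {∞}     = top

  ≈∞⇒finite : ∀ {x r} → x ≈∞ fin r → IsFinite x × real x ≈ r
  ≈∞⇒finite (fin x≈r) = fin _ , x≈r

-- Attainment of the Basic LP optimum

module BasicLP (R : Reals) (q : ℕ) where
  open OrderedField R
  open MinCSP R q
  open Sums R
  open ExtendedProperties R
  open LinearProgramming R
  open ≤-Reasoning

  value∈[0,1] : ∀ c → 0# ≤ real (value c) × real (value c) ≤ 1#
  value∈[0,1] (cost r 0≤r r≤1) = 0≤r , r≤1
  value∈[0,1] ∞                = ≤-refl , 0≤1

  module _ {Φ : CostFamily} (I : Instance Φ) where
    open Instance I

    private
      S = BasicLPSolution I
      X = (Vertex × Label) ⊎ Σ Edge (λ e → Vec Label (arity e))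

    -- Equivalent to a finite `lpValue`. As a condition on single variables it can join the linear
    -- constraints, after which the objective is the linear function `lpReal`.
    NoInfiniteMass : (∀ e → Vec Label (arity e) → Carrier) → Set
    NoInfiniteMass y = ∀ e α → y e α ≤ 0# ⊎ IsFinite (value (Ψ e α))

    lpReal : (∀ e → Vec Label (arity e) → Carrier) → Carrier
    lpReal y = ∑ (allFin edgeCount) λ e →
      weight e * ∑ (words q (arity e)) λ α → y e α * real (value (Ψ e α))

    module _ (s : S) where
      open BasicLPSolution s

      private
        edgeValue : Edge → Ext
        edgeValue e = sumWords∞ (arity e) λ α → y e α ⊙ value (Ψ e α)

      lpValue-finite⁻ : IsFinite (lpValue I s) → NoInfiniteMass y
      lpValue-finite⁻ fs e α = finite-⊙⁻ (y e α) (value (Ψ e α))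
        (finite-sumWords⁻ (arity e) (λ α → y e α ⊙ value (Ψ e α))
          (finite-⊙⁻-pos (edgeValue e) (weight>0 e)
            (finite-sum⁻ (λ e → weight e ⊙ edgeValue e) fs e)) α)

      module _ (nim : NoInfiniteMass y) where

        private
          term-finite : ∀ e α → IsFinite (y e α ⊙ value (Ψ e α))
          term-finite e α with nim e α
          ... | inj₁ y≤0 = finite-⊙-≤0 y≤0 (value (Ψ e α))
          ... | inj₂ fs  = finite-⊙ (y e α) fs

          edge-finite : ∀ e → IsFinite (edgeValue e)
          edge-finite e = finite-sumWords (arity e) _ (term-finite e)

        lpValue-finite : IsFinite (lpValue I s)
        lpValue-finite = finite-sum _ λ e → finite-⊙ (weight e) (edge-finite e)

        real-lpValue : real (lpValue I s) ≈ lpReal y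
        real-lpValue = begin-equality
          real (lpValue I s)
            ≈⟨ real-sum (λ e → weight e ⊙ edgeValue e) (λ e → finite-⊙ (weight e) (edge-finite e)) ⟩
          sumFin (λ e → real (weight e ⊙ edgeValue e))
            ≈⟨ sumFin≈∑ edgeCount _ ⟩
          ∑ (allFin edgeCount) (λ e → real (weight e ⊙ edgeValue e))
            ≈⟨ ∑-cong (allFin edgeCount) (λ e → ≈-trans (real-⊙ (weight e) (edgeValue e)) (*-congˡ
                 (≈-trans (real-sumWords (arity e) _ (term-finite e))
                   (∑-cong (words q (arity e)) (λ α → real-⊙ (y e α) (value (Ψ e α))))))) ⟩
          lpReal y ∎

    lpReal-nonNeg : ∀ {y} → (∀ e α → 0# ≤ y e α) → 0# ≤ lpReal y
    lpReal-nonNeg y≥0 = ∑-nonNeg (allFin edgeCount) λ e → *-nonNeg (proj₁ (weight>0 e))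
      (∑-nonNeg (words q (arity e)) λ α →
        *-nonNeg (y≥0 e α) (proj₁ (value∈[0,1] (Ψ e α))))

    private
      data Kind : Set where
        ≥0 ≤1 =0 : Kind

      K = (Kind × X) ⊎ (Bool × Vertex) ⊎ (Bool × Σ Edge λ e → Fin (arity e) × Label)

      finite-X : Finite X
      finite-X = finite-⊎ (finite-Σ (finite-Fin _) λ _ → finite-Fin q)
                          (finite-Σ (finite-Fin _) λ e → finite-words q (arity e))

      finite-Kind : Finite Kind
      finite-Kind = record
        { elements = ≥0 ∷ ≤1 ∷ =0 ∷ []
        ; complete = λ { ≥0 → here refl ; ≤1 → there (here refl) ; =0 → there (there (here refl)) }
        }

      finite-Bool : Finite Bool
      finite-Bool = record
        { elements = true ∷ false ∷ []
        ; complete = λ { true → here refl ; false → there (here refl) }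
        }

      finite-K : Finite K
      finite-K = finite-⊎ (finite-Σ finite-Kind λ _ → finite-X)
        (finite-⊎ (finite-Σ finite-Bool λ _ → finite-Fin _)
                  (finite-Σ finite-Bool λ _ → finite-Σ (finite-Fin _) λ e →
                     finite-Σ (finite-Fin (arity e)) λ _ → finite-Fin q))

      -- Zeros are forced by two sources: candidate lists, and words of infinite cost, which a
      -- solution of finite value has to avoid.
      MustVanish : X → Set
      MustVanish (inj₁ (v , a)) = a ∉ list v
      MustVanish (inj₂ (e , α)) = ¬ IsFinite (value (Ψ e α))

      mustVanish? : ∀ u → Dec (MustVanish u)
      mustVanish? (inj₁ (v , a)) = ¬? (a ∈? list v)
      mustVanish? (inj₂ (e , α)) = ¬? (isFinite? (value (Ψ e α)))

      -- An equation becomes two inequalities, selected by the Boolean.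
      difference : Expr X → Expr X → Bool → Expr X
      difference φ ψ true  = φ ⊞ (- 1#) ⊡ ψ
      difference φ ψ false = ψ ⊞ (- 1#) ⊡ φ

      xᵉ : Vertex → Label → Expr X
      xᵉ v a = var (inj₁ (v , a))

      yᵉ : ∀ e → Vec Label (arity e) → Expr X
      yᵉ e α = var (inj₂ (e , α))

      sumᵉ : Vertex → Expr X
      sumᵉ v = ∑ᵉ (allFin q) (xᵉ v)

      marginalᵉ : ∀ e → Fin (arity e) → Label → Expr X
      marginalᵉ e p a = ∑ᵉ (words q (arity e)) λ α → [ lookup α p Fin.≟ a ] ⊡ yᵉ e α

      constraint : K → Expr X
      constraint (inj₁ (≥0 , u)) = var u
      constraint (inj₁ (≤1 , u)) = con 1# ⊞ (- 1#) ⊡ var u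
      -- Only `u` ≤ 0 is imposed here, since `≥0` supplies the other half; variables without a
      -- forced zero get the trivial constraint 0 ≥ 0.
      constraint (inj₁ (=0 , u)) = if does (mustVanish? u) then (- 1#) ⊡ var u else con 0#
      constraint (inj₂ (inj₁ (b , v))) = difference (sumᵉ v) (con 1#) b
      constraint (inj₂ (inj₂ (b , e , p , a))) =
        difference (xᵉ (lookup (vertices e) p) a) (marginalᵉ e p a) b

      objective : Expr X
      objective = ∑ᵉ (allFin edgeCount) λ e →
        weight e ⊡ ∑ᵉ (words q (arity e)) λ α → real (value (Ψ e α)) ⊡ yᵉ e α

      Feasible : (X → Carrier) → Set
      Feasible f = ∀ k → 0# ≤ ⟦ constraint k ⟧ f

      module _ (f : X → Carrier) where

        ⟦difference⟧⁺ : ∀ φ ψ → ⟦ φ ⟧ f ≈ ⟦ ψ ⟧ f → ∀ b → 0# ≤ ⟦ difference φ ψ b ⟧ f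
        ⟦difference⟧⁺ φ ψ φ≈ψ true  = ≤-respʳ (+-congˡ (≈-sym (-1*x≈-x _)))
          (≤⇒0≤- (≤-reflexive (≈-sym φ≈ψ)))
        ⟦difference⟧⁺ φ ψ φ≈ψ false = ≤-respʳ (+-congˡ (≈-sym (-1*x≈-x _)))
          (≤⇒0≤- (≤-reflexive φ≈ψ))

        ⟦difference⟧⁻ : ∀ φ ψ → (∀ b → 0# ≤ ⟦ difference φ ψ b ⟧ f) → ⟦ φ ⟧ f ≈ ⟦ ψ ⟧ f
        ⟦difference⟧⁻ φ ψ 0≤ = antisym
          (0≤-⇒≤ (≤-respʳ (+-congˡ (-1*x≈-x _)) (0≤ false)))
          (0≤-⇒≤ (≤-respʳ (+-congˡ (-1*x≈-x _)) (0≤ true)))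

        ⟦sum⟧ : ∀ v → ⟦ sumᵉ v ⟧ f ≈ sumFin (λ a → f (inj₁ (v , a)))
        ⟦sum⟧ v = ≈-trans (≈-reflexive (⟦∑ᵉ⟧ (allFin q) (xᵉ v) f)) (≈-sym (sumFin≈∑ q _))

        ⟦marginal⟧ : ∀ e p a → ⟦ marginalᵉ e p a ⟧ f ≈
          sumWords (arity e) λ α → if does (lookup α p Fin.≟ a) then f (inj₂ (e , α)) else 0#
        ⟦marginal⟧ e p a = begin-equality
          ⟦ marginalᵉ e p a ⟧ f
            ≡⟨ ⟦∑ᵉ⟧ (words q (arity e)) _ f ⟩
          ∑ (words q (arity e)) (λ α → [ lookup α p Fin.≟ a ] * f (inj₂ (e , α)))
            ≈⟨ ∑-cong (words q (arity e)) (λ α → []-* (lookup α p Fin.≟ a) (f (inj₂ (e , α)))) ⟨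
          ∑ (words q (arity e)) (λ α → if does (lookup α p Fin.≟ a) then f (inj₂ (e , α)) else 0#)
            ≈⟨ sumWords≈∑ q (arity e) _ ⟨
          sumWords (arity e) (λ α → if does (lookup α p Fin.≟ a) then f (inj₂ (e , α)) else 0#) ∎

        ⟦objective⟧ : ⟦ objective ⟧ f ≈ lpReal (λ e α → f (inj₂ (e , α)))
        ⟦objective⟧ = ≈-trans (≈-reflexive (⟦∑ᵉ⟧ (allFin edgeCount) _ f))
          (∑-cong (allFin edgeCount) λ e → *-congˡ
            (≈-trans (≈-reflexive (⟦∑ᵉ⟧ (words q (arity e)) _ f))
              (∑-cong (words q (arity e)) λ α → *-comm _ _)))

        vanish⁺ : ∀ u → (MustVanish u → f u ≤ 0#) → 0# ≤ ⟦ constraint (inj₁ (=0 , u)) ⟧ f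
        vanish⁺ u f≤0 with mustVanish? u
        ... | yes p = ≤-respʳ (≈-sym (-1*x≈-x _)) (≤0⇒0≤- (f≤0 p))
        ... | no _  = ≤-refl

        vanish⁻ : ∀ u → 0# ≤ ⟦ constraint (inj₁ (=0 , u)) ⟧ f → MustVanish u → f u ≤ 0#
        vanish⁻ u 0≤ p with mustVanish? u
        ... | yes _ = 0≤-⇒≤ (≤-respʳ (≈-trans (-1*x≈-x _) (≈-sym (+-identityˡ _))) 0≤)
        ... | no ¬p = ⊥-elim (¬p p)

      toSolution : ∀ f → Feasible f → S
      toSolution f feas = record
        { x          = λ v a → f (inj₁ (v , a))
        ; x≥0        = λ v a → feas (inj₁ (≥0 , inj₁ (v , a)))
        ; x≤1        = λ v a → f≤1 (inj₁ (v , a))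
        ; x-sum      = λ v → ≈-trans (≈-sym (⟦sum⟧ f v))
            (⟦difference⟧⁻ f (sumᵉ v) (con 1#) λ b → feas (inj₂ (inj₁ (b , v))))
        ; x-list     = λ v a a∉ → antisym
            (vanish⁻ f (inj₁ (v , a)) (feas (inj₁ (=0 , inj₁ (v , a)))) a∉)
            (feas (inj₁ (≥0 , inj₁ (v , a))))
        ; y          = λ e α → f (inj₂ (e , α))
        ; y≥0        = λ e α → feas (inj₁ (≥0 , inj₂ (e , α)))
        ; y≤1        = λ e α → f≤1 (inj₂ (e , α))
        ; y-marginal = λ e p a → ≈-trans
            (⟦difference⟧⁻ f (xᵉ (lookup (vertices e) p) a) (marginalᵉ e p a)
              λ b → feas (inj₂ (inj₂ (b , e , p , a))))
            (⟦marginal⟧ f e p a)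
        }
        where
        f≤1 : ∀ u → f u ≤ 1#
        f≤1 u = 0≤-⇒≤ (≤-respʳ (+-congˡ (-1*x≈-x _)) (feas (inj₁ (≤1 , u))))

      toSolution-noInfiniteMass : ∀ f feas → NoInfiniteMass (BasicLPSolution.y (toSolution f feas))
      toSolution-noInfiniteMass f feas e α with isFinite? (value (Ψ e α))
      ... | yes fs = inj₂ fs
      ... | no ¬fs = inj₁ (vanish⁻ f (inj₂ (e , α)) (feas (inj₁ (=0 , inj₂ (e , α)))) ¬fs)

      assignment : S → X → Carrier
      assignment s (inj₁ (v , a)) = BasicLPSolution.x s v a
      assignment s (inj₂ (e , α)) = BasicLPSolution.y s e α

      assignment-feasible : ∀ s → NoInfiniteMass (BasicLPSolution.y s) → Feasible (assignment s)
      assignment-feasible s nim = λ where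
          (inj₁ (≥0 , inj₁ (v , a))) → x≥0 v a
          (inj₁ (≥0 , inj₂ (e , α))) → y≥0 e α
          (inj₁ (≤1 , inj₁ (v , a))) → ≤-respʳ (+-congˡ (≈-sym (-1*x≈-x _))) (≤⇒0≤- (x≤1 v a))
          (inj₁ (≤1 , inj₂ (e , α))) → ≤-respʳ (+-congˡ (≈-sym (-1*x≈-x _))) (≤⇒0≤- (y≤1 e α))
          (inj₁ (=0 , inj₁ (v , a))) → vanish⁺ f (inj₁ (v , a)) λ a∉ → ≤-reflexive (x-list v a a∉)
          (inj₁ (=0 , inj₂ (e , α))) → vanish⁺ f (inj₂ (e , α)) (y≤0 e α (nim e α))
          (inj₂ (inj₁ (b , v))) →
            ⟦difference⟧⁺ f (sumᵉ v) (con 1#) (≈-trans (⟦sum⟧ f v) (x-sum v)) b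
          (inj₂ (inj₂ (b , e , p , a))) →
            ⟦difference⟧⁺ f (xᵉ (lookup (vertices e) p) a) (marginalᵉ e p a)
              (≈-trans (y-marginal e p a) (≈-sym (⟦marginal⟧ f e p a))) b
        where
        open BasicLPSolution s
        f = assignment s
        y≤0 : ∀ e α → y e α ≤ 0# ⊎ IsFinite (value (Ψ e α)) →
              ¬ IsFinite (value (Ψ e α)) → y e α ≤ 0#
        y≤0 e α (inj₁ y≤0) _   = y≤0
        y≤0 e α (inj₂ fs)  ¬fs = ⊥-elim (¬fs fs)

    -- The solution of finite value is a feasible starting point, and nonnegative costs bound the
    -- objective below by 0, so elimination applies.
    lp-minimum : (s : S) → IsFinite (lpValue I s) →
                 ∃[ l ] IsMinimum (lpValue I) (fin l) × 0# ≤ l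
    lp-minimum s₀ fs₀ = lpReal y , ((s , value≈) , minimal) , lpReal-nonNeg y≥0
      where
      optimum = minimiseExpr finite-X finite-K constraint objective 0#
        (λ f feas → ≤-respʳ (≈-sym (⟦objective⟧ f))
          (lpReal-nonNeg λ e α → feas (inj₁ (≥0 , inj₂ (e , α)))))
        (assignment s₀) (assignment-feasible s₀ (lpValue-finite⁻ s₀ fs₀))
      f    = proj₁ optimum
      feas = proj₁ (proj₂ optimum)
      s    = toSolution f feas
      open BasicLPSolution s using (y; y≥0)
      nim  = toSolution-noInfiniteMass f feas

      value≈ : lpValue I s ≈∞ fin (lpReal y)
      value≈ = ≡.subst (_≈∞ fin (lpReal y)) (≡.sym (fin-real (lpValue-finite s nim)))
        (fin (real-lpValue s nim))

      minimal : ∀ s′ → fin (lpReal y) ≤∞ lpValue I s′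
      -- Competitors of infinite value are excluded by `≤∞-real`; the remaining ones are feasible
      -- for the linear program.
      minimal s′ = ≤∞-real λ fs′ → let nim′ = lpValue-finite⁻ s′ fs′ in begin
        lpReal y                                  ≈⟨ ⟦objective⟧ f ⟨
        ⟦ objective ⟧ f                           ≤⟨ proj₂ (proj₂ optimum) (assignment s′)
                                                       (assignment-feasible s′ nim′) ⟩
        ⟦ objective ⟧ (assignment s′)             ≈⟨ ⟦objective⟧ (assignment s′) ⟩
        lpReal (BasicLPSolution.y s′)             ≈⟨ real-lpValue s′ nim′ ⟨
        real (lpValue I s′)                       ∎

-- Orbits of a permutation group

first : ∀ {n} → (Fin n → Bool) → Maybe (Fin n)
first {zero}  P = nothing
first {suc n} P = if P zero then just zero else Maybe.map suc (first (P ∘ suc))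

first-cong : ∀ {n} {P Q : Fin n → Bool} → (∀ i → P i ≡ Q i) → first P ≡ first Q
first-cong {zero}  P≗Q = refl
first-cong {suc n} P≗Q rewrite P≗Q zero | first-cong (P≗Q ∘ suc) = refl

first-just : ∀ {n} (P : Fin n → Bool) i → P i ≡ true → ∃[ k ] first P ≡ just k × P k ≡ true
first-just {suc n} P i Pi with P zero in eq
... | true = zero , refl , eq
first-just {suc n} P zero Pi | false with () ← ≡.trans (≡.sym eq) Pi
first-just {suc n} P (suc i) Pi | false with first-just (P ∘ suc) i Pi
... | k , eq′ , Pk = suc k , ≡.cong (Maybe.map suc) eq′ , Pk

module Orbits {N : ℕ} (G : PermutationGroup N) where
  open PermutationGroup G

  Word : Set
  Word = Vec (Fin N) N

  -- Group elements are represented by their value tables, so that the group becomes a decidable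
  -- part of the finite list of all N^N words.
  InGroup : Word → Set
  InGroup w = ∃[ σ ] Member σ × (∀ v → σ ⟨$⟩ʳ v ≡ lookup w v)

  private
    Inverses : Word → Word → Set
    Inverses w w′ = (∀ v → lookup w (lookup w′ v) ≡ v) × (∀ v → lookup w′ (lookup w v) ≡ v)

    inverses? : ∀ w w′ → Dec (Inverses w w′)
    inverses? w w′ = Fin.all? (λ v → lookup w (lookup w′ v) Fin.≟ v) ×-dec
                     Fin.all? (λ v → lookup w′ (lookup w v) Fin.≟ v)

    toPermutation : ∀ w w′ → Inverses w w′ → Permutation′ N
    toPermutation w w′ (ww′ , w′w) = permutation (lookup w) (lookup w′) ww′ w′w

    -- A table determines a permutation only together with an inverse table, so membership is
    -- decided by a search for the latter; `resp` makes the answer independent of the inverse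
    -- proofs.
    MemberWithInverse : Word → Word → Set
    MemberWithInverse w w′ = Σ (Inverses w w′) λ inv → Member (toPermutation w w′ inv)

    memberWithInverse? : ∀ w w′ → Dec (MemberWithInverse w w′)
    memberWithInverse? w w′ with inverses? w w′
    ... | no ¬inv = no (¬inv ∘ proj₁)
    ... | yes inv with member? (toPermutation w w′ inv)
    ...   | yes mem = yes (inv , mem)
    ...   | no ¬mem = no λ (inv′ , mem′) → ¬mem (resp (λ _ → refl) mem′)

  abstract
    inGroup? : ∀ w → Dec (InGroup w)
    inGroup? w = map′ to from (Any.any? (memberWithInverse? w) (words N N))
      where
      to : Any.Any (MemberWithInverse w) (words N N) → InGroup w
      to any = let w′ , inv , mem = Any.satisfied any in toPermutation w w′ inv , mem , λ _ → refl
      from : InGroup w → Any.Any (MemberWithInverse w) (words N N)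
      from (σ , mem , σ≗w) = List.lose (∈-words w′) (inv , resp σ≗w mem)
        where
        w′ : Word
        w′ = Vec.tabulate (σ ⟨$⟩ˡ_)
        w′≗ : ∀ v → lookup w′ v ≡ σ ⟨$⟩ˡ v
        w′≗ = Vec.lookup∘tabulate (σ ⟨$⟩ˡ_)
        inv : Inverses w w′
        inv = (λ v → ≡.trans (≡.sym (σ≗w _)) (≡.trans (≡.cong (σ ⟨$⟩ʳ_) (w′≗ v)) (Perm.inverseʳ σ)))
            , (λ v → ≡.trans (w′≗ _) (≡.trans (≡.cong (σ ⟨$⟩ˡ_) (≡.sym (σ≗w v))) (Perm.inverseˡ σ)))

  infixl 7 _⋆_
  -- Right translation, the table of w ∘ τ.
  _⋆_ : Word → Permutation′ N → Word
  w ⋆ τ = Vec.tabulate λ v → lookup w (τ ⟨$⟩ʳ v)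

  lookup-⋆ : ∀ w τ v → lookup (w ⋆ τ) v ≡ lookup w (τ ⟨$⟩ʳ v)
  lookup-⋆ w τ = Vec.lookup∘tabulate _

  ⋆-inverse : ∀ w τ ρ → (∀ v → τ ⟨$⟩ʳ (ρ ⟨$⟩ʳ v) ≡ v) → (w ⋆ τ) ⋆ ρ ≡ w
  ⋆-inverse w τ ρ τρ = ≡.trans
    (Vec.tabulate-cong λ v → ≡.trans (lookup-⋆ w τ _) (≡.cong (lookup w) (τρ v)))
    (Vec.tabulate∘lookup w)

  inGroup-⋆ : ∀ w {τ} → Member τ → InGroup w → InGroup (w ⋆ τ)
  inGroup-⋆ w {τ} τ∈ (σ , σ∈ , σ≗w) =
    τ ∘ₚ σ , ∘∈ τ∈ σ∈ , λ v → ≡.trans (σ≗w _) (≡.sym (lookup-⋆ w τ v))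

  infix 4 _∼_
  _∼_ : Fin N → Fin N → Set
  v ∼ u = ∃[ σ ] Member σ × σ ⟨$⟩ʳ v ≡ u

  abstract
    _∼?_ : ∀ v u → Dec (v ∼ u)
    v ∼? u = map′ to from (Any.any? (λ w → inGroup? w ×-dec (lookup w v Fin.≟ u)) (words N N))
      where
      to : Any.Any (λ w → InGroup w × lookup w v ≡ u) (words N N) → v ∼ u
      to any = let w , (σ , σ∈ , σ≗w) , wv≡u = Any.satisfied any in σ , σ∈ , ≡.trans (σ≗w v) wv≡u
      from : v ∼ u → Any.Any (λ w → InGroup w × lookup w v ≡ u) (words N N)
      from (σ , σ∈ , σv≡u) = List.lose (∈-words (Vec.tabulate (σ ⟨$⟩ʳ_)))
        ( (σ , σ∈ , λ v → ≡.sym (Vec.lookup∘tabulate (σ ⟨$⟩ʳ_) v))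
        , ≡.trans (Vec.lookup∘tabulate (σ ⟨$⟩ʳ_) v) σv≡u )

  ∼-refl : ∀ v → v ∼ v
  ∼-refl v = Perm.id , id∈ , refl

  ∼-sym : ∀ {v u} → v ∼ u → u ∼ v
  ∼-sym (σ , σ∈ , refl) = Perm.flip σ , inverse∈ σ∈ , Perm.inverseˡ σ

  ∼-trans : ∀ {v u t} → v ∼ u → u ∼ t → v ∼ t
  ∼-trans (σ , σ∈ , refl) (τ , τ∈ , refl) = σ ∘ₚ τ , ∘∈ σ∈ τ∈ , refl

  -- The least element of the orbit; the search always succeeds because `v` lies in its own orbit.
  rep : Fin N → Fin N
  rep v = fromMaybe v (first λ u → does (v ∼? u))

  private
    rep-first : ∀ v → ∃[ k ] first (λ u → does (v ∼? u)) ≡ just k × v ∼ k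
    rep-first v with first-just (λ u → does (v ∼? u)) v (dec-true (v ∼? v) (∼-refl v))
    ... | k , eq , v∼?k with v ∼? k
    ...   | yes v∼k = k , eq , v∼k

  ∼-rep : ∀ v → v ∼ rep v
  ∼-rep v with rep-first v
  ... | k , eq , v∼k rewrite eq = v∼k

  -- Vertices of one orbit have the same orbit predicate, and `first` depends only on its values.
  rep-cong : ∀ {v u} → v ∼ u → rep v ≡ rep u
  rep-cong {v} {u} v∼u with rep-first v | rep-first u
  ... | k , eq , _ | k′ , eq′ , _ = ≡.trans (≡.cong (fromMaybe v) (≡.trans same eq′))
                                            (≡.sym (≡.cong (fromMaybe u) eq′))
    where
    same : first (λ t → does (v ∼? t)) ≡ first (λ t → does (u ∼? t))
    same = first-cong λ t →
      does-⇔ (mk⇔ (∼-trans (∼-sym v∼u)) (∼-trans v∼u)) (v ∼? t) (u ∼? t)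

-- Averages over the group

module Averaging (R : Reals) {N : ℕ} (G : PermutationGroup N) where
  open OrderedField R
  open Sums R
  open PermutationGroup G
  open Orbits G
  open ≤-Reasoning

  private
    𝕎 = words N N

    order : Carrier
    order = ∑ 𝕎 λ w → [ inGroup? w ]

    order>0 : 0# < order
    order>0 = <-≤-trans 0<1 (≤-respˡ ([]-yes (inGroup? e) e∈)
      (∑-term (λ w → []-nonNeg (inGroup? w)) (∈-words e)))
      where
      e : Word
      e = Vec.tabulate id
      e∈ : InGroup e
      e∈ = Perm.id , id∈ , λ v → ≡.sym (Vec.lookup∘tabulate id v)

    order⁻¹ = proj₁ (inverse⁺ order>0)

    weights : Word → Carrier
    weights w = order⁻¹ * [ inGroup? w ]

    weights-nonNeg : ∀ w → 0# ≤ weights w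
    weights-nonNeg w = *-nonNeg (proj₁ (proj₂ (proj₂ (inverse⁺ order>0)))) ([]-nonNeg (inGroup? w))

  -- Expectation over a uniform group element, as a weighted sum over all words so that it
  -- interchanges with other sums.
  average : (Word → Carrier) → Carrier
  average f = ∑ 𝕎 λ w → weights w * f w

  average-nonNeg : ∀ {f} → (∀ w → 0# ≤ f w) → 0# ≤ average f
  average-nonNeg 0≤f = ∑-nonNeg 𝕎 λ w → *-nonNeg (weights-nonNeg w) (0≤f w)

  -- Agreement on the group suffices because all other words have weight zero.
  average-cong : ∀ {f g} → (∀ w → InGroup w → f w ≈ g w) → average f ≈ average g
  average-cong {f} {g} f≈g = ∑-cong 𝕎 term
    where
    term : ∀ w → weights w * f w ≈ weights w * g w
    term w = begin-equality
      (order⁻¹ * [ inGroup? w ]) * f w  ≈⟨ *-assoc _ _ _ ⟩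
      order⁻¹ * ([ inGroup? w ] * f w)  ≈⟨ *-congˡ ([]-*-cong (inGroup? w) (f≈g w)) ⟩
      order⁻¹ * ([ inGroup? w ] * g w)  ≈⟨ *-assoc _ _ _ ⟨
      (order⁻¹ * [ inGroup? w ]) * g w  ∎

  average-const : ∀ c → average (λ _ → c) ≈ c
  average-const c = begin-equality
    ∑ 𝕎 (λ w → weights w * c)                ≈⟨ ∑-*ʳ 𝕎 c weights ⟩
    ∑ 𝕎 weights * c                          ≈⟨ *-congʳ (∑-*ˡ 𝕎 order⁻¹ (λ w → [ inGroup? w ])) ⟩
    (order⁻¹ * order) * c                    ≈⟨ *-congʳ (≈-trans (*-comm _ _) (proj₁ (proj₂ (inverse⁺ order>0)))) ⟩
    1# * c                                   ≈⟨ *-identityˡ c ⟩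
    c                                        ∎

  average-mono : ∀ {f g} → (∀ w → f w ≤ g w) → average f ≤ average g
  average-mono f≤g = ∑-mono 𝕎 λ w → *-monoʳ-≤ (weights-nonNeg w) (f≤g w)

  ∑-average : ∀ {A : Set} (as : List A) (f : A → Word → Carrier) →
              ∑ as (λ a → average (f a)) ≈ average (λ w → ∑ as (λ a → f a w))
  ∑-average as f = ≈-trans (∑-swap as 𝕎 _) (∑-cong 𝕎 λ w → ∑-*ˡ as (weights w) _)

  average-*ˡ : ∀ c f → average (λ w → c * f w) ≈ c * average f
  average-*ˡ c f = ≈-trans (∑-cong 𝕎 λ w →
    solve 3 (λ p c f → p :* (c :* f) := c :* (p :* f)) ≈-refl (weights w) c (f w)) (∑-*ˡ 𝕎 c _)

  -- Right translation permutes the words and preserves membership in both directions, hence the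
  -- weights.
  average-⋆ : ∀ {τ} → Member τ → ∀ f → average (λ w → f (w ⋆ τ)) ≈ average f
  average-⋆ {τ} τ∈ f = ≈-trans (∑-cong 𝕎 λ w → *-congʳ (*-congˡ ([]-⇔ (inGroup? w) (inGroup? (w ⋆ τ))
      (inGroup-⋆ w τ∈)
      (λ wτ∈ → ≡.subst InGroup (⋆-inverse w τ (Perm.flip τ) (λ _ → Perm.inverseʳ τ))
                 (inGroup-⋆ (w ⋆ τ) (inverse∈ τ∈) wτ∈)))))
    (∑-reindex (_⋆ τ) (_⋆ Perm.flip τ)
      (λ w → ⋆-inverse w (Perm.flip τ) τ (λ _ → Perm.inverseˡ τ))
      (λ w → ⋆-inverse w τ (Perm.flip τ) (λ _ → Perm.inverseʳ τ))
      (λ w → weights w * f w))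

  -- If u is τ v, then w sends u where w ∘ τ sends v. This makes the averaged marginals constant on
  -- orbits.
  average-∼ : ∀ {v u} → v ∼ u → ∀ f → average (λ w → f (lookup w u)) ≈ average (λ w → f (lookup w v))
  average-∼ {v} (τ , τ∈ , refl) f = ≈-trans
    (average-cong λ w _ → ≈-reflexive (≡.cong f (≡.sym (lookup-⋆ w τ v))))
    (average-⋆ τ∈ (λ w → f (lookup w v)))

-- Rare labels and collisions

module Sampling (R : Reals) where
  open OrderedField R
  open Sums R
  open ≤-Reasoning

  ·-mono-≤ : ∀ {m n} → m ℕ.≤ n → m · 1# ≤ n · 1#
  ·-mono-≤ {n = n} ℕ.z≤n = ·-nonNeg n
  ·-mono-≤ (ℕ.s≤s m≤n)   = +-mono-≤ ≤-refl (·-mono-≤ m≤n)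

  n<1+n : ∀ n → n · 1# < suc n · 1#
  n<1+n n = ≰⇒< λ 1+n≤n → <⇒≰ 0<1 (begin
    1#                                ≈⟨ x+[y-x]≈y (n · 1#) 1# ⟨
    n · 1# + (1# - n · 1#)            ≈⟨ solve 3 (λ n o m → n :+ (o :+ m) := (o :+ n) :+ m) ≈-refl (n · 1#) 1# (- (n · 1#)) ⟩
    suc n · 1# - n · 1#               ≤⟨ +-monoˡ-≤ (- (n · 1#)) 1+n≤n ⟩
    n · 1# - n · 1#                   ≈⟨ -‿inverseʳ (n · 1#) ⟩
    0#                                ∎)

  hits : ∀ {n j} → Fin n → Vec (Fin n) j → Carrier
  hits i []      = 0#
  hits i (k ∷ s) = [ i Fin.≟ k ] + hits i s

  hits-nonNeg : ∀ {n j} (i : Fin n) (s : Vec (Fin n) j) → 0# ≤ hits i s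
  hits-nonNeg i []      = ≤-refl
  hits-nonNeg i (k ∷ s) = +-nonNeg ([]-nonNeg (i Fin.≟ k)) (hits-nonNeg i s)

  fresh-or-hit : ∀ {n j} (i : Fin n) (s : Vec (Fin n) j) → VecAll.All (i ≢_) s ⊎ 1# ≤ hits i s
  fresh-or-hit i []      = inj₁ []
  fresh-or-hit i (k ∷ s) with i Fin.≟ k | fresh-or-hit i s
  ... | yes _  | _         = inj₂ (x≤x+y (hits-nonNeg i s))
  ... | no i≢k | inj₁ i∉s  = inj₁ (i≢k ∷ i∉s)
  ... | no _   | inj₂ hit  = inj₂ (≤-respʳ (≈-sym (+-identityˡ _)) hit)

  ∑-hits : ∀ {n j} (s : Vec (Fin n) j) → ∑ (allFin n) (λ i → hits i s) ≈ j · 1#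
  ∑-hits {n} []      = ∑-zero (allFin n) λ _ → ≈-refl
  ∑-hits {n} (k ∷ s) = ≈-trans (∑-+ (allFin n) (λ i → [ i Fin.≟ k ]) _) (+-cong
    (≈-trans (∑-cong (allFin n) λ i → ≈-sym (*-identityʳ _)) (∑-δ k (λ _ → 1#))) (∑-hits s))

  -- Bad coordinates plus coinciding pairs, each pair counted at its earlier entry. This dominates
  -- the indicator of failure, and its mean is a union bound.
  penalty : ∀ {n j} → (Fin j → Fin n → Carrier) → Vec (Fin n) j → Carrier
  penalty bad []      = 0#
  penalty bad (i ∷ s) = penalty (bad ∘ suc) s + (bad zero i + hits i s)

  module _ {n r} (nr≈1 : (n · 1#) * r ≈ 1#) (0≤r : 0# ≤ r) where

    private
      ^-nonNeg : ∀ j → 0# ≤ r ^ j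
      ^-nonNeg zero    = 0≤1
      ^-nonNeg (suc j) = *-nonNeg 0≤r (^-nonNeg j)

    -- The union bound, one coordinate at a time.
    expected-penalty : ∀ {M B} j → j ℕ.≤ M → (bad : Fin j → Fin n → Carrier) →
                       (∀ v → ∑ (allFin n) (bad v) ≤ B) →
                       r ^ j * ∑ (words n j) (penalty bad) ≤ (j · 1#) * (r * (B + M · 1#))
    expected-penalty {M} {B} zero j≤M bad bad≤B = ≤-reflexive (begin-equality
      1# * (0# + 0#)              ≈⟨ *-identityˡ _ ⟩
      0# + 0#                     ≈⟨ +-identityʳ 0# ⟩
      0#                          ≈⟨ zeroˡ _ ⟨
      0# * (r * (B + M · 1#))     ∎)
    expected-penalty {M} {B} (suc j) j<M bad bad≤B = begin
      (r * r ^ j) * ∑ (words n (suc j)) (penalty bad)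
        ≈⟨ *-congˡ split ⟩
      (r * r ^ j) * ((n · 1#) * ∑P + ∑ 𝕊 (λ s → ∑ 𝕀 (bad zero) + j · 1#))
        -- The j positions already taken are rounded up to M, so that every coordinate contributes
        -- the same amount.
        ≤⟨ *-monoʳ-≤ (*-nonNeg 0≤r (^-nonNeg j)) (+-mono-≤ ≤-refl
             (∑-mono 𝕊 λ s → ≤-respʳ (≈-sym (*-identityʳ _))
               (+-mono-≤ (bad≤B zero) (·-mono-≤ (ℕ.<⇒≤ j<M))))) ⟩
      (r * r ^ j) * ((n · 1#) * ∑P + ∑ 𝕊 (λ s → (B + M · 1#) * 1#))
        ≈⟨ *-congˡ (+-congˡ (∑-*ˡ 𝕊 (B + M · 1#) (λ _ → 1#))) ⟩
      (r * r ^ j) * ((n · 1#) * ∑P + (B + M · 1#) * ∑ 𝕊 (λ _ → 1#))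
        ≈⟨ solve 6 (λ r p n P b o → (r :* p) :* (n :* P :+ b :* o) :=
                      (n :* r) :* (p :* P) :+ (p :* o) :* (r :* b)) ≈-refl
             r (r ^ j) (n · 1#) ∑P (B + M · 1#) (∑ 𝕊 (λ _ → 1#)) ⟩
      ((n · 1#) * r) * (r ^ j * ∑P) + (r ^ j * ∑ 𝕊 (λ _ → 1#)) * (r * (B + M · 1#))
        ≈⟨ +-cong (≈-trans (*-congʳ nr≈1) (*-identityˡ _)) (*-congʳ (uniform-total nr≈1 j)) ⟩
      r ^ j * ∑P + 1# * (r * (B + M · 1#))
        ≤⟨ +-mono-≤ (expected-penalty j (ℕ.<⇒≤ j<M) (bad ∘ suc) (bad≤B ∘ suc)) ≤-refl ⟩
      (j · 1#) * (r * (B + M · 1#)) + 1# * (r * (B + M · 1#))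
        ≈⟨ ≈-trans (+-comm _ _) (≈-sym (distribʳ _ 1# (j · 1#))) ⟩
      (suc j · 1#) * (r * (B + M · 1#)) ∎
      where
      𝕀 = allFin n
      𝕊 = words n j
      P = penalty (bad ∘ suc)
      ∑P = ∑ 𝕊 P
      split : ∑ (words n (suc j)) (penalty bad) ≈
              (n · 1#) * ∑P + ∑ 𝕊 (λ s → ∑ 𝕀 (bad zero) + j · 1#)
      split = begin-equality
        ∑ (words n (suc j)) (penalty bad)
          ≈⟨ ∑-words-suc n j (penalty bad) ⟩
        ∑ 𝕀 (λ i → ∑ 𝕊 (λ s → P s + (bad zero i + hits i s)))
          ≈⟨ ∑-cong 𝕀 (λ i → ∑-+ 𝕊 P _) ⟩
        ∑ 𝕀 (λ i → ∑P + ∑ 𝕊 (λ s → bad zero i + hits i s))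
          ≈⟨ ∑-+ 𝕀 (λ _ → ∑P) _ ⟩
        ∑ 𝕀 (λ _ → ∑P) + ∑ 𝕀 (λ i → ∑ 𝕊 (λ s → bad zero i + hits i s))
          ≈⟨ +-cong (∑-const n ∑P) (∑-swap 𝕀 𝕊 _) ⟩
        (n · 1#) * ∑P + ∑ 𝕊 (λ s → ∑ 𝕀 (λ i → bad zero i + hits i s))
          ≈⟨ +-congˡ (∑-cong 𝕊 λ s → ≈-trans (∑-+ 𝕀 (bad zero) _) (+-congˡ (∑-hits s))) ⟩
        (n · 1#) * ∑P + ∑ 𝕊 (λ s → ∑ 𝕀 (bad zero) + j · 1#) ∎

  penalty-nonNeg : ∀ {n j} (bad : Fin j → Fin n → Carrier) → (∀ v i → 0# ≤ bad v i) →
                   ∀ s → 0# ≤ penalty bad s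
  penalty-nonNeg bad 0≤bad []      = ≤-refl
  penalty-nonNeg bad 0≤bad (i ∷ s) = +-nonNeg (penalty-nonNeg (bad ∘ suc) (0≤bad ∘ suc) s)
    (+-nonNeg (0≤bad zero i) (hits-nonNeg i s))

  good-or-penalised : ∀ {n j} {Bad : Fin j → Fin n → Set} (bad? : ∀ v i → Dec (Bad v i)) →
                      ∀ s → (Unique s × (∀ v → ¬ Bad v (lookup s v))) ⊎
                            1# ≤ penalty (λ v i → [ bad? v i ]) s
  good-or-penalised bad? []      = inj₁ ([] , λ ())
  good-or-penalised bad? (i ∷ s)
    with good-or-penalised (λ v → bad? (suc v)) s | bad? zero i | fresh-or-hit i s
  ... | inj₂ 1≤p | d | _ = inj₂ (≤-trans 1≤p (x≤x+y (+-nonNeg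
        ([]-nonNeg d) (hits-nonNeg i s))))
  ... | inj₁ _ | yes bad | _ = inj₂ (≤-trans (x≤x+y (hits-nonNeg i s)) (x≤y+x
        (penalty-nonNeg (λ v i → [ bad? (suc v) i ]) (λ v i → []-nonNeg (bad? (suc v) i)) s)))
  ... | inj₁ _ | no _ | inj₂ hit = inj₂ (≤-trans hit (≤-trans (x≤y+x ≤-refl)
        (x≤y+x (penalty-nonNeg (λ v i → [ bad? (suc v) i ]) (λ v i → []-nonNeg (bad? (suc v) i)) s))))
  ... | inj₁ (unique , good) | no ¬bad | inj₁ i∉s = inj₁
        ( i∉s ∷ unique , λ { zero → ¬bad ; (suc v) → good v } )

  module _ {n q : ℕ} (M : ℕ) (m : Fin n → Fin q) where

    count : Fin q → Carrier
    count a = ∑ (allFin n) λ i → [ a Fin.≟ m i ]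

    Common : Fin q → Set
    Common a = M · 1# ≤ count a

    common? : ∀ a → Dec (Common a)
    common? a = M · 1# ≤? count a

    -- Group the positions by label: each of the q labels contributes nothing or, if rare, at most
    -- M.
    count-rare : ∑ (allFin n) (λ i → [ ¬? (common? (m i)) ]) ≤ (q · 1#) * (M · 1#)
    count-rare = begin
      ∑ 𝕀 (λ i → rare (m i))
        ≈⟨ ∑-cong 𝕀 (λ i → ∑-δ (m i) rare) ⟨
      ∑ 𝕀 (λ i → ∑ 𝕃 (λ a → [ a Fin.≟ m i ] * rare a))
        ≈⟨ ∑-swap 𝕀 𝕃 _ ⟩
      ∑ 𝕃 (λ a → ∑ 𝕀 (λ i → [ a Fin.≟ m i ] * rare a))
        ≈⟨ ∑-cong 𝕃 (λ a → ∑-*ʳ 𝕀 (rare a) _) ⟩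
      ∑ 𝕃 (λ a → count a * rare a)
        ≤⟨ ∑-mono 𝕃 bound ⟩
      ∑ 𝕃 (λ _ → M · 1#)
        ≈⟨ ∑-const q (M · 1#) ⟩
      (q · 1#) * (M · 1#) ∎
      where
      𝕀 = allFin n
      𝕃 = allFin q
      rare : Fin q → Carrier
      rare a = [ ¬? (common? a) ]
      bound : ∀ a → count a * rare a ≤ M · 1#
      bound a with common? a
      ... | yes _ = ≤-respˡ (≈-sym (zeroʳ _)) (·-nonNeg M)
      ... | no ¬c = ≤-respˡ (≈-sym (*-identityʳ _)) (proj₁ (≰⇒< ¬c))

    -- Otherwise all n positions would be rare, against `count-rare`.
    exists-common : (q · 1#) * (M · 1#) < n · 1# → ∃[ i ] Common (m i)
    exists-common qM<n with Fin.any? (λ i → common? (m i))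
    ... | yes p = p
    ... | no ¬p = ⊥-elim (<⇒≰ qM<n (begin
      n · 1#                     ≈⟨ *-identityʳ _ ⟨
      (n · 1#) * 1#              ≈⟨ ∑-const n 1# ⟨
      ∑ (allFin n) (λ _ → 1#)    ≤⟨ ∑-mono (allFin n) (λ i → ≤-reflexive (≈-sym
                                      ([]-yes (¬? (common? (m i))) λ c → ¬p (i , c)))) ⟩
      ∑ (allFin n) (λ i → [ ¬? (common? (m i)) ])  ≤⟨ count-rare ⟩
      (q · 1#) * (M · 1#)        ∎))

    -- Pigeonhole: at least M positions carry the label, and s blocks at most j < M of them.
    fresh : ∀ {j} → j ℕ.< M → (s : Vec (Fin n) j) → ∀ {a} → Common a →
            ∃[ i ] a ≡ m i × VecAll.All (i ≢_) s
    fresh {j} j<M s {a} common with Fin.any? (λ i → (a Fin.≟ m i) ×-dec VecAll.all? (λ k → ¬? (i Fin.≟ k)) s)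
    ... | yes p = p
    ... | no ¬p = ⊥-elim (<⇒≰ (n<1+n j) (begin
      suc j · 1#                           ≤⟨ ·-mono-≤ j<M ⟩
      M · 1#                               ≤⟨ common ⟩
      count a                              ≤⟨ ∑-mono (allFin n) covered ⟩
      ∑ (allFin n) (λ i → hits i s)        ≈⟨ ∑-hits s ⟩
      j · 1#                               ∎))
      where
      covered : ∀ i → [ a Fin.≟ m i ] ≤ hits i s
      covered i with a Fin.≟ m i | fresh-or-hit i s
      ... | no _     | _        = hits-nonNeg i s
      ... | yes _    | inj₂ hit = hit
      ... | yes a≡mi | inj₁ i∉s = ⊥-elim (¬p (i , a≡mi , i∉s))

  -- Greedy choice: when a coordinate is treated, fewer than M positions are taken.
  choose-distinct : ∀ {n q} M j → j ℕ.≤ M → (m : Fin j → Fin n → Fin q) (a : Fin j → Fin q) →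
                    (∀ v → Common M (m v) (a v)) →
                    ∃[ s ] Unique s × (∀ v → a v ≡ m v (lookup s v))
  choose-distinct M zero    j≤M m a common = [] , [] , λ ()
  choose-distinct M (suc j) j<M m a common
    with choose-distinct M j (ℕ.<⇒≤ j<M) (m ∘ suc) (a ∘ suc) (common ∘ suc)
  ... | s , unique , a≡ms with fresh M (m zero) j<M s (common zero)
  ...   | i , a≡mi , i∉s = i ∷ s , i∉s ∷ unique , λ { zero → a≡mi ; (suc v) → a≡ms v }

-- Costs of labelings and values of fractional solutions

module CostProperties (R : Reals) (q : ℕ) where
  open OrderedField R
  open MinCSP R q
  open Sums R
  open ExtendedProperties R
  open BasicLP R q using (value∈[0,1])
  open ≤-Reasoning

  least-on : ∀ {A : Set} (f : A → Ext) {P : A → Set} → (∀ a → Dec (P a)) →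
             ∀ as → ∃ P → ∃[ b ] P b × (∀ {a} → a List.∈ as → P a → f b ≤∞ f a)
  least-on f P? []       (b , Pb) = b , Pb , λ ()
  least-on f P? (a ∷ as) witness with least-on f P? as witness | P? a
  ... | b , Pb , b≤ | no ¬Pa = b , Pb , λ where
    (here refl) Pa → ⊥-elim (¬Pa Pa)
    (there a∈)  Pa → b≤ a∈ Pa
  ... | b , Pb , b≤ | yes Pa with ≤∞-total (f a) (f b)
  ...   | inj₁ fa≤fb = a , Pa , λ where
    (here refl) _   → ≤∞-refl
    (there a∈)  Pa′ → ≤∞-trans fa≤fb (b≤ a∈ Pa′)
  ...   | inj₂ fb≤fa = b , Pb , λ where
    (here refl) _   → fb≤fa
    (there a∈)  Pa′ → b≤ a∈ Pa′

  module _ {Φ : CostFamily} (I : Instance Φ) where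
    open Instance I

    -- Labelings are functions here, since they are composed with permutations and with choices of
    -- copies.
    edgeCost : (Vertex → Label) → Edge → Ext
    edgeCost f e = value (Ψ e (Vec.map f (vertices e)))

    EdgesFinite : (Vertex → Label) → Set
    EdgesFinite f = ∀ e → IsFinite (edgeCost f e)

    realCost : (Vertex → Label) → Carrier
    realCost f = ∑ (allFin edgeCount) λ e → weight e * real (edgeCost f e)

    totalWeight : Carrier
    totalWeight = ∑ (allFin edgeCount) weight

    totalWeight-nonNeg : 0# ≤ totalWeight
    totalWeight-nonNeg = ∑-nonNeg (allFin edgeCount) (proj₁ ∘ weight>0)

    edgeCost-cong : ∀ {f g} → (∀ v → f v ≡ g v) → ∀ e → edgeCost f e ≡ edgeCost g e
    edgeCost-cong f≗g e = ≡.cong (value ∘ Ψ e) (Vec.map-cong f≗g (vertices e))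

    realCost-cong : ∀ {f g} → (∀ v → f v ≡ g v) → realCost f ≈ realCost g
    realCost-cong f≗g = ∑-cong (allFin edgeCount) λ e →
      *-congˡ (≈-reflexive (≡.cong real (edgeCost-cong f≗g e)))

    edgesFinite-cong : ∀ {f g} → (∀ v → f v ≡ g v) → EdgesFinite f → EdgesFinite g
    edgesFinite-cong f≗g fs e = ≡.subst IsFinite (edgeCost-cong f≗g e) (fs e)

    realCost-nonNeg : ∀ f → 0# ≤ realCost f
    realCost-nonNeg f = ∑-nonNeg (allFin edgeCount) λ e →
      *-nonNeg (proj₁ (weight>0 e)) (proj₁ (value∈[0,1] (Ψ e _)))

    realCost≤totalWeight : ∀ f → realCost f ≤ totalWeight
    realCost≤totalWeight f = ∑-mono (allFin edgeCount) λ e → ≤-respʳ (*-identityʳ _)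
      (*-monoʳ-≤ (proj₁ (weight>0 e)) (proj₂ (value∈[0,1] (Ψ e _))))

    costOf-finite : ∀ ℓ → EdgesFinite (lookup ℓ) → IsFinite (costOf I ℓ)
    costOf-finite ℓ fs = finite-sum _ λ e → finite-⊙ (weight e) (fs e)

    costOf-finite⁻ : ∀ ℓ → IsFinite (costOf I ℓ) → EdgesFinite (lookup ℓ)
    costOf-finite⁻ ℓ fs e = finite-⊙⁻-pos (edgeCost (lookup ℓ) e) (weight>0 e)
      (finite-sum⁻ (λ e → weight e ⊙ edgeCost (lookup ℓ) e) fs e)

    real-costOf : ∀ ℓ → EdgesFinite (lookup ℓ) → real (costOf I ℓ) ≈ realCost (lookup ℓ)
    real-costOf ℓ fs = begin-equality
      real (costOf I ℓ)
        ≈⟨ real-sum (λ e → weight e ⊙ edgeCost (lookup ℓ) e) (λ e → finite-⊙ (weight e) (fs e)) ⟩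
      sumFin (λ e → real (weight e ⊙ edgeCost (lookup ℓ) e))
        ≈⟨ sumFin≈∑ edgeCount _ ⟩
      ∑ (allFin edgeCount) (λ e → real (weight e ⊙ edgeCost (lookup ℓ) e))
        ≈⟨ ∑-cong (allFin edgeCount) (λ e → real-⊙ (weight e) (edgeCost (lookup ℓ) e)) ⟩
      realCost (lookup ℓ) ∎

    labeling-minimum : Labeling I → ∃[ opt ] IsMinimum {Labeling I} (costOf I ∘ proj₁) opt
    labeling-minimum witness
      with least-on (costOf I) (λ ℓ → Fin.all? λ v → lookup ℓ v ∈? list v)
             (words q vertexCount) witness
    ... | ℓ , ℓ∈ , minimal =
      costOf I ℓ , ((ℓ , ℓ∈) , ≈∞-refl) , λ (ℓ′ , ℓ′∈) → minimal (∈-words ℓ′) ℓ′∈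

    module _ (s : FractionalSolution I) where
      open FractionalSolution s

      probability : Vec Label vertexCount → Carrier
      probability ℓ = product (λ v → x v (lookup ℓ v))

      probability-nonNeg : ∀ ℓ → 0# ≤ probability ℓ
      probability-nonNeg ℓ = product-nonNeg _ λ v → x≥0 v (lookup ℓ v)

      -- Infinite costs are harmless exactly where the probability vanishes; there both sides have a
      -- zero term.
      real-multilinear : (∀ ℓ → probability ℓ ≈ 0# ⊎ EdgesFinite (lookup ℓ)) →
                         IsFinite (multilinearValue I s) ×
                         real (multilinearValue I s) ≈
                           ∑ (words q vertexCount) (λ ℓ → probability ℓ * realCost (lookup ℓ))
      real-multilinear support = finite-sumWords vertexCount _ term-finite , (begin-equality
        real (multilinearValue I s)
          ≈⟨ real-sumWords vertexCount _ term-finite ⟩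
        ∑ (words q vertexCount) (λ ℓ → real (probability ℓ ⊙ costOf I ℓ))
          ≈⟨ ∑-cong (words q vertexCount) (λ ℓ →
               ≈-trans (real-⊙ (probability ℓ) (costOf I ℓ)) (term ℓ (support ℓ))) ⟩
        ∑ (words q vertexCount) (λ ℓ → probability ℓ * realCost (lookup ℓ)) ∎)
        where
        term-finite : ∀ ℓ → IsFinite (probability ℓ ⊙ costOf I ℓ)
        term-finite ℓ with support ℓ
        ... | inj₁ p≈0 = finite-⊙-≤0 (≤-reflexive p≈0) (costOf I ℓ)
        ... | inj₂ fs  = finite-⊙ (probability ℓ) (costOf-finite ℓ fs)
        term : ∀ ℓ → probability ℓ ≈ 0# ⊎ EdgesFinite (lookup ℓ) →
               probability ℓ * real (costOf I ℓ) ≈ probability ℓ * realCost (lookup ℓ)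
        term ℓ (inj₁ p≈0) = ≈-trans (≈-trans (*-congʳ p≈0) (zeroˡ _))
                              (≈-sym (≈-trans (*-congʳ p≈0) (zeroˡ _)))
        term ℓ (inj₂ fs)  = *-congˡ (real-costOf ℓ fs)

      -- The value is an average of costs, and labelings that violate a list have probability zero.
      multilinear-lower-bound : ∀ c → (∀ (ℓ : Labeling I) → fin c ≤∞ costOf I (proj₁ ℓ)) →
                                fin c ≤∞ multilinearValue I s
      multilinear-lower-bound c c≤ = ≤∞-real λ fs →
        let support : ∀ ℓ → probability ℓ ≈ 0# ⊎ EdgesFinite (lookup ℓ)
            support ℓ = support′ ℓ (finite-⊙⁻ (probability ℓ) (costOf I ℓ)
              (finite-sumWords⁻ vertexCount (λ ℓ → probability ℓ ⊙ costOf I ℓ) fs ℓ))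
        in begin
        c
          ≈⟨ *-identityʳ c ⟨
        c * 1#
          ≈⟨ *-congˡ (∑-product-distribution vertexCount x x-sum) ⟨
        c * ∑ (words q vertexCount) probability
          ≈⟨ ∑-*ˡ (words q vertexCount) c probability ⟨
        ∑ (words q vertexCount) (λ ℓ → c * probability ℓ)
          ≤⟨ ∑-mono (words q vertexCount) (λ ℓ → ≤-respˡ (*-comm _ c) (term ℓ (support ℓ))) ⟩
        ∑ (words q vertexCount) (λ ℓ → probability ℓ * realCost (lookup ℓ))
          ≈⟨ proj₂ (real-multilinear support) ⟨
        real (multilinearValue I s) ∎
        where
        support′ : ∀ ℓ → probability ℓ ≤ 0# ⊎ IsFinite (costOf I ℓ) →
                   probability ℓ ≈ 0# ⊎ EdgesFinite (lookup ℓ)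
        support′ ℓ (inj₁ p≤0) = inj₁ (antisym p≤0 (probability-nonNeg ℓ))
        support′ ℓ (inj₂ fs)  = inj₂ (costOf-finite⁻ ℓ fs)

        zero-term : ∀ ℓ → probability ℓ ≈ 0# → probability ℓ * c ≤ probability ℓ * realCost (lookup ℓ)
        zero-term ℓ p≈0 = ≤-reflexive (≈-trans (≈-trans (*-congʳ p≈0) (zeroˡ _))
                            (≈-sym (≈-trans (*-congʳ p≈0) (zeroˡ _))))

        term : ∀ ℓ → probability ℓ ≈ 0# ⊎ EdgesFinite (lookup ℓ) →
               probability ℓ * c ≤ probability ℓ * realCost (lookup ℓ)
        term ℓ (inj₁ p≈0) = zero-term ℓ p≈0
        term ℓ (inj₂ fs) with Fin.all? (λ v → lookup ℓ v ∈? list v)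
        ... | yes ℓ∈ = *-monoʳ-≤ (probability-nonNeg ℓ) (≤-respʳ (real-costOf ℓ fs)
          (fin≤∞⁻ (≡.subst (fin c ≤∞_) (fin-real (costOf-finite ℓ fs)) (c≤ (ℓ , ℓ∈)))))
        ... | no ℓ∉ with Fin.¬∀⟶∃¬ vertexCount _ (λ v → lookup ℓ v ∈? list v) ℓ∉
        ...   | v , ∉ = zero-term ℓ (product-zero _ v (x-list v (lookup ℓ v) ∉))

      -- With an empty list the probabilities at v would sum to 0.
      supported-label : ∀ v → ∃[ a ] a ∈ list v
      supported-label v with Fin.any? (λ a → a ∈? list v)
      ... | yes p = p
      ... | no ¬p = ⊥-elim (0≉1 (begin-equality
        0#                  ≈⟨ ∑-zero (allFin q) (λ a → x-list v a (λ a∈ → ¬p (a , a∈))) ⟨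
        ∑ (allFin q) (x v)  ≈⟨ sumFin≈∑ q (x v) ⟨
        sumFin (x v)        ≈⟨ x-sum v ⟩
        1#                  ∎))

      private
        below-value : ∀ {b} → multilinearValue I s ≈∞ fin b →
                      ∀ c → (∀ (ℓ : Labeling I) → fin c ≤∞ costOf I (proj₁ ℓ)) → c ≤ b
        below-value value≈b c c≤ with multilinearValue I s | value≈b | multilinear-lower-bound c c≤
        ... | fin _ | fin v≈b | fin c≤v = ≤-respʳ v≈b c≤v

      -- Derandomisation: the best integral labeling costs no more than the expectation. It is the
      -- labeling that the LP solution of the blow-up averages.
      cheap-labeling : ∀ {b} → multilinearValue I s ≈∞ fin b →
                       ∃[ f ] (∀ v → f v ∈ list v) × EdgesFinite f × realCost f ≤ b
      cheap-labeling {b} value≈b with labeling-minimum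
        ( Vec.tabulate (λ v → proj₁ (supported-label v))
        , λ v → ≡.subst (_∈ list v) (≡.sym (Vec.lookup∘tabulate _ v)) (proj₂ (supported-label v)) )
      ... | fin c , ((ℓ , ℓ∈) , ℓ≈c) , c≤ = lookup ℓ , ℓ∈ , fs , (begin
              realCost (lookup ℓ)             ≈⟨ real-costOf ℓ fs ⟨
              real (costOf I ℓ)               ≈⟨ proj₂ (≈∞⇒finite ℓ≈c) ⟩
              c                               ≤⟨ below-value value≈b c c≤ ⟩
              b                               ∎)
        where
        fs = costOf-finite⁻ ℓ (proj₁ (≈∞⇒finite ℓ≈c))
      -- If all labelings cost ∞, every real number is a lower bound, in particular b + 1.
      ... | ∞ , _ , ∞≤ = ⊥-elim (<⇒≰ (<-+1 b) (below-value value≈b (b + 1#) λ ℓ → ≤∞-trans top (∞≤ ℓ)))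
        where
        <-+1 : ∀ b → b < b + 1#
        <-+1 b = ≰⇒< λ b+1≤b → <⇒≰ 0<1 (begin
          1#                ≈⟨ x+[y-x]≈y b 1# ⟨
          b + (1# - b)      ≈⟨ +-assoc b 1# (- b) ⟨
          (b + 1#) - b      ≤⟨ +-monoˡ-≤ (- b) b+1≤b ⟩
          b - b             ≈⟨ -‿inverseʳ b ⟩
          0#                ∎)

    module _ (G : PermutationGroup vertexCount) (sym : IsSymmetricInstance I G) where
      open PermutationGroup G

      private
        image-cost : ∀ {n σ j k} {h : Hyperedge Φ n j} {h′ : Hyperedge Φ n k} → IsImage σ h h′ →
                     let open Hyperedge in ∀ f →
                     value (Ψ h′ (Vec.map f (vertices h′))) ≈∞
                       value (Ψ h (Vec.map (f ∘ (σ ⟨$⟩ʳ_)) (vertices h))) ×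
                     weight h′ ≈ weight h
        image-cost {σ = σ} {h = h} {h′} (image vs Ψ≈ w≈) f = ≡.subst
          (λ α → value (Hyperedge.Ψ h′ (Vec.map f (Hyperedge.vertices h′))) ≈∞ value (Hyperedge.Ψ h α))
          (≡.trans (≡.cong (Vec.map f) vs) (≡.sym (Vec.map-∘ f (σ ⟨$⟩ʳ_) (Hyperedge.vertices h))))
          (Ψ≈ _) , w≈

        real-cong : ∀ {x y} → x ≈∞ y → real x ≈ real y
        real-cong (fin x≈y) = x≈y
        real-cong top       = ≈-refl

        finite-resp : ∀ {x y} → x ≈∞ y → IsFinite x → IsFinite y
        finite-resp (fin _) _ = fin _

      edgesFinite-symmetric : ∀ {σ f} → Member σ → EdgesFinite f → EdgesFinite (f ∘ (σ ⟨$⟩ʳ_))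
      edgesFinite-symmetric {σ} {f} σ∈ fs e =
        let _ , π , images = sym σ σ∈ in
        finite-resp (proj₁ (image-cost (images e) f)) (fs (π ⟨$⟩ʳ e))

      -- The labeling f ∘ σ pays on e what f pays on π e, so the terms are merely permuted.
      realCost-symmetric : ∀ {σ} f → Member σ → realCost (f ∘ (σ ⟨$⟩ʳ_)) ≈ realCost f
      realCost-symmetric {σ} f σ∈ = let _ , π , images = sym σ σ∈ in begin-equality
        realCost (f ∘ (σ ⟨$⟩ʳ_))
          ≈⟨ ∑-cong (allFin edgeCount) (λ e → let c , w = image-cost (images e) f in
               *-cong (≈-sym w) (≈-sym (real-cong c))) ⟩
        ∑ (allFin edgeCount) (λ e → term (π ⟨$⟩ʳ e))
          ≈⟨ sumFin≈∑ edgeCount _ ⟨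
        sumFin (λ e → term (π ⟨$⟩ʳ e))
          ≈⟨ MonoidSum.sum-permute (CommutativeRing.+-commutativeMonoid commutativeRing) term π ⟨
        sumFin term
          ≈⟨ sumFin≈∑ edgeCount term ⟩
        realCost f ∎
        where
        term : Edge → Carrier
        term e = weight e * real (edgeCost f e)

-- The blow-up instance

unique? : ∀ {n j} (s : Vec (Fin n) j) → Dec (Unique s)
unique? = allPairs? λ i k → ¬? (i Fin.≟ k)

-- The proofs are retained because each copy of a hyperedge needs the injectivity of its choice to
-- have distinct vertices.
collect : ∀ {A : Set} {P : A → Set} → (∀ a → Dec (P a)) → List A → List (Σ A P)
collect P? [] = []
collect P? (a ∷ as) with P? a
... | yes p = (a , p) ∷ collect P? as
... | no _  = collect P? as

-- The stored proof is the one found by `P?`, hence the existential.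
∈-collect : ∀ {A : Set} {P : A → Set} (P? : ∀ a → Dec (P a)) {as a} → a List.∈ as → P a →
            ∃[ p ] (a , p) List.∈ collect P? as
∈-collect P? {a ∷ as} (here refl) p with P? a
... | yes p′ = p′ , here refl
... | no ¬p  = ⊥-elim (¬p p)
∈-collect P? {a ∷ as} (there a∈) p with P? a | ∈-collect P? a∈ p
... | yes _ | p′ , ∈′ = p′ , there ∈′
... | no _  | p′ , ∈′ = p′ , ∈′

module BlowUp (R : Reals) (q : ℕ) where
  open OrderedField R
  open MinCSP R q
  open Sums R
  open ExtendedProperties R
  open BasicLP R q
  open CostProperties R q
  open Sampling R
  open ≤-Reasoning

  ∑-collect : ∀ {A : Set} {P : A → Set} (P? : ∀ a → Dec (P a)) as (f : A → Carrier) →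
              ∑ (collect P? as) (λ (a , _) → f a) ≈ ∑ as (λ a → [ P? a ] * f a)
  ∑-collect P? [] f = ≈-refl
  ∑-collect P? (a ∷ as) f with P? a
  ... | yes _ = +-cong (≈-sym (*-identityˡ _)) (∑-collect P? as f)
  ... | no _  = ≈-trans (∑-collect P? as f)
                  (≈-sym (≈-trans (+-congʳ (zeroˡ _)) (+-identityˡ _)))

  module _ {Φ : CostFamily} (I : Instance Φ) (G : PermutationGroup (Instance.vertexCount I))
           (sym : IsSymmetricInstance I G)
           (n : ℕ) (r : Carrier) (nr≈1 : (n · 1#) * r ≈ 1#) (0<r : 0# < r) where
    open Instance I
    open PermutationGroup G using (Member)
    open Orbits G
    open Averaging R G

    private
      N = vertexCount
      𝕊 = words n N
      𝔼 = allFin edgeCount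

    -- The probability n^(-N) of one choice of positions. As a weight factor it turns the cost in
    -- the blow-up into an expectation over choices, restricted to the injective ones.
    ρ : Carrier
    ρ = r ^ N

    0<ρ : 0# < ρ
    0<ρ = ^-pos 0<r N

    Slots : Set
    Slots = Σ (Vec (Fin n) N) Unique

    slots : List Slots
    slots = collect unique? 𝕊

    edges′ : List (Slots × Edge)
    edges′ = concatMap (λ s → List.map (s ,_) 𝔼) slots

    place : Slots → Vertex → Fin (N ℕ.* n)
    place (s , _) v = combine (rep v) (lookup s v)

    -- Copy numbers alone separate the vertices, including those that share a representative.
    place-injective : ∀ s {v u} → place s v ≡ place s u → v ≡ u
    place-injective (s , unique) {v} {u} eq =
      Unique.lookup-injective unique v u (Fin.combine-injectiveʳ (rep v) _ (rep u) _ eq)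

    edge′ : ((s , e) : Slots × Edge) → Hyperedge Φ (N ℕ.* n) (arity e)
    edge′ (s , e) = record
      { vertices = Vec.map (place s) (vertices e)
      ; distinct = Unique.map⁺ (place-injective s) (distinct e)
      ; Ψ        = Ψ e
      ; Ψ∈Φ      = Ψ∈Φ e
      ; weight   = weight e * ρ
      ; weight>0 = *-pos (weight>0 e) 0<ρ
      }

    base : Fin (N ℕ.* n) → Vertex
    base u = proj₁ (remQuot {N} n u)

    base-combine : ∀ v (i : Fin n) → base (combine v i) ≡ v
    base-combine v i = ≡.cong proj₁ (Fin.remQuot-combine v i)

    blowUp : Instance Φ
    blowUp = record
      { vertexCount = N ℕ.* n
      ; list        = list ∘ base
      ; edgeCount   = length edges′
      ; arity       = λ k → arity (proj₂ (List.lookup edges′ k))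
      ; edge        = λ k → edge′ (List.lookup edges′ k)
      }

    ∑-edges′ : ∀ (F : Slots → Edge → Carrier) →
               ∑ (allFin (length edges′)) (λ k → F (proj₁ (List.lookup edges′ k)) (proj₂ (List.lookup edges′ k))) ≈
               ∑ slots (λ s → ∑ 𝔼 (F s))
    ∑-edges′ F = begin-equality
      ∑ (allFin (length edges′)) (λ k → F (proj₁ (List.lookup edges′ k)) (proj₂ (List.lookup edges′ k)))
        ≈⟨ sumFin≈∑ (length edges′) _ ⟨
      sumFin (λ k → F (proj₁ (List.lookup edges′ k)) (proj₂ (List.lookup edges′ k)))
        ≈⟨ ∑-lookup edges′ (λ (s , e) → F s e) ⟩
      ∑ edges′ (λ (s , e) → F s e)
        ≈⟨ ∑-Σ slots (λ _ → 𝔼) _,_ (λ (s , e) → F s e) ⟩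
      ∑ slots (λ s → ∑ 𝔼 (F s)) ∎

    list-∼ : ∀ {v u} → v ∼ u → list u ≡ list v
    list-∼ (σ , σ∈ , refl) = proj₁ (sym σ σ∈) _

    module AveragedLabeling (f : Vertex → Label) (f∈list : ∀ v → f v ∈ list v) (f-finite : EdgesFinite I f) where

      private
        ∑-indicator : ∀ (k : Label) → ∑ (allFin q) (λ a → [ a Fin.≟ k ]) ≈ 1#
        ∑-indicator k = ≈-trans (∑-cong (allFin q) λ a → ≈-sym (*-identityʳ _)) (∑-δ k (λ _ → 1#))

        moved : ∀ e → Word → Vec Label (arity e)
        moved e w = Vec.map (f ∘ lookup w) (vertices e)

        x : Vertex → Label → Carrier
        x v a = average λ w → [ a Fin.≟ f (lookup w v) ]

        -- The joint law of `f ∘ w` on e for one random group element w, so that its marginals are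
        -- those of `x`.
        y : ∀ e → Vec Label (arity e) → Carrier
        y e α = average λ w → [ α ≟ʷ moved e w ]

        average-[]≤1 : ∀ {P : Word → Set} (d : ∀ w → Dec (P w)) → average (λ w → [ d w ]) ≤ 1#
        average-[]≤1 d = ≤-respʳ (average-const 1#) (average-mono λ w → []-≤1 (d w))

        marginal : ∀ e p a → x (lookup (vertices e) p) a ≈
                   sumWords (arity e) λ α → if does (lookup α p Fin.≟ a) then y e α else 0#
        marginal e p a = ≈-sym (begin-equality
          sumWords (arity e) (λ α → if does (lookup α p Fin.≟ a) then y e α else 0#)
            ≈⟨ sumWords≈∑ q (arity e) _ ⟩
          ∑ 𝔸 (λ α → if does (lookup α p Fin.≟ a) then y e α else 0#)
            ≈⟨ ∑-cong 𝔸 (λ α → ≈-trans ([]-* (lookup α p Fin.≟ a) (y e α)) (≈-trans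
                 (≈-sym (average-*ˡ [ lookup α p Fin.≟ a ] (λ w → [ α ≟ʷ moved e w ])))
                 (average-cong λ w _ → *-comm [ lookup α p Fin.≟ a ] [ α ≟ʷ moved e w ]))) ⟩
          ∑ 𝔸 (λ α → average (λ w → [ α ≟ʷ moved e w ] * [ lookup α p Fin.≟ a ]))
            ≈⟨ ∑-average 𝔸 (λ α w → [ α ≟ʷ moved e w ] * [ lookup α p Fin.≟ a ]) ⟩
          average (λ w → ∑ 𝔸 (λ α → [ α ≟ʷ moved e w ] * [ lookup α p Fin.≟ a ]))
            ≈⟨ average-cong (λ w _ → ∑-δ-words (moved e w) (λ α → [ lookup α p Fin.≟ a ])) ⟩
          average (λ w → [ lookup (moved e w) p Fin.≟ a ])
            ≈⟨ average-cong (λ w _ →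
                 let eq = Vec.lookup-map p (f ∘ lookup w) (vertices e) in
                 []-⇔ (lookup (moved e w) p Fin.≟ a) (a Fin.≟ f (lookup w (lookup (vertices e) p)))
                   (λ ≡a → ≡.trans (≡.sym ≡a) eq) (λ a≡ → ≡.trans eq (≡.sym a≡))) ⟩
          x (lookup (vertices e) p) a ∎)
          where 𝔸 = words q (arity e)

      solution : BasicLPSolution blowUp
      solution = record
        { x          = x ∘ base
        ; x≥0        = λ u a → average-nonNeg λ w → []-nonNeg (a Fin.≟ f (lookup w (base u)))
        ; x≤1        = λ u a → average-[]≤1 λ w → a Fin.≟ f (lookup w (base u))
        ; x-sum      = λ u → begin-equality
            sumFin (x (base u))
              ≈⟨ sumFin≈∑ q _ ⟩
            ∑ (allFin q) (x (base u))
              ≈⟨ ∑-average (allFin q) (λ a w → [ a Fin.≟ f (lookup w (base u)) ]) ⟩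
            average (λ w → ∑ (allFin q) (λ a → [ a Fin.≟ f (lookup w (base u)) ]))
              ≈⟨ average-cong (λ w _ → ∑-indicator (f (lookup w (base u)))) ⟩
            average (λ _ → 1#)
              ≈⟨ average-const 1# ⟩
            1# ∎
        ; x-list     = λ u a a∉ → ≈-trans
            (average-cong λ w (σ , σ∈ , σ≗w) → []-no (a Fin.≟ f (lookup w (base u))) λ where
              refl → a∉ (≡.subst (f (lookup w (base u)) ∈_)
                (list-∼ (σ , σ∈ , σ≗w (base u))) (f∈list (lookup w (base u)))))
            (average-const 0#)
        -- All copies of a hyperedge share one local distribution.
        ; y          = λ k → y (proj₂ (List.lookup edges′ k))
        ; y≥0        = λ k α → average-nonNeg λ w →
            []-nonNeg (α ≟ʷ moved (proj₂ (List.lookup edges′ k)) w)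
        ; y≤1        = λ k α → average-[]≤1 λ w → α ≟ʷ moved (proj₂ (List.lookup edges′ k)) w
        ; y-marginal = λ k p a →
            let s , e = List.lookup edges′ k
                v = lookup (vertices e) p
                base≡ = ≡.trans (≡.cong base (Vec.lookup-map p (place s) (vertices e)))
                                (base-combine (rep v) (lookup (proj₁ s) v))
            -- The copy of v carries the marginal of `rep v`, which equals that of v by `average-∼`.
            in ≈-trans (≈-reflexive (≡.cong (λ u → x u a) base≡))
                 (≈-trans (average-∼ (∼-rep v) (λ u → [ a Fin.≟ f u ])) (marginal e p a))
        }

      private
        moved-finite : ∀ w → InGroup w → EdgesFinite I (f ∘ lookup w)
        moved-finite w (σ , σ∈ , σ≗w) = edgesFinite-cong I (λ v → ≡.cong f (σ≗w v))
          (edgesFinite-symmetric I G sym σ∈ f-finite)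

        moved-cost : ∀ w → InGroup w → realCost I (f ∘ lookup w) ≈ realCost I f
        moved-cost w (σ , σ∈ , σ≗w) = ≈-trans (realCost-cong I λ v → ≡.cong f (≡.sym (σ≗w v)))
          (realCost-symmetric I G sym f σ∈)

        noInfiniteMass : ∀ e α → y e α ≤ 0# ⊎ IsFinite (value (Ψ e α))
        noInfiniteMass e α with isFinite? (value (Ψ e α))
        ... | yes fs = inj₂ fs
        ... | no ¬fs = inj₁ (≤-reflexive (≈-trans
                (average-cong λ w w∈ → []-no (α ≟ʷ moved e w) λ where refl → ¬fs (moved-finite w w∈ e))
                (average-const 0#)))

        edge-value : ∀ e → ∑ (words q (arity e)) (λ α → y e α * real (value (Ψ e α))) ≈
                     average (λ w → real (edgeCost I (f ∘ lookup w) e))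
        edge-value e = begin-equality
          ∑ 𝔸 (λ α → y e α * c α)
            ≈⟨ ∑-cong 𝔸 (λ α → ≈-trans (*-comm _ _) (≈-trans
                 (≈-sym (average-*ˡ (c α) (λ w → [ α ≟ʷ moved e w ])))
                 (average-cong λ w _ → *-comm (c α) _))) ⟩
          ∑ 𝔸 (λ α → average (λ w → [ α ≟ʷ moved e w ] * c α))
            ≈⟨ ∑-average 𝔸 (λ α w → [ α ≟ʷ moved e w ] * c α) ⟩
          average (λ w → ∑ 𝔸 (λ α → [ α ≟ʷ moved e w ] * c α))
            ≈⟨ average-cong (λ w _ → ∑-δ-words (moved e w) c) ⟩
          average (λ w → c (moved e w)) ∎
          where
          𝔸 = words q (arity e)
          c : Vec Label (arity e) → Carrier
          c α = real (value (Ψ e α))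

        copy-value : ∑ 𝔼 (λ e → (weight e * ρ) * ∑ (words q (arity e)) (λ α → y e α * real (value (Ψ e α)))) ≈
                     ρ * realCost I f
        copy-value = begin-equality
          ∑ 𝔼 (λ e → (weight e * ρ) * ∑ (words q (arity e)) (λ α → y e α * real (value (Ψ e α))))
            ≈⟨ ∑-cong 𝔼 (λ e → ≈-trans (*-congˡ (edge-value e)) (≈-trans (*-congʳ (*-comm _ ρ))
                 (≈-trans (*-assoc ρ _ _) (*-congˡ (≈-sym (average-*ˡ (weight e) _)))))) ⟩
          ∑ 𝔼 (λ e → ρ * average (λ w → weight e * real (edgeCost I (f ∘ lookup w) e)))
            ≈⟨ ∑-*ˡ 𝔼 ρ _ ⟩
          ρ * ∑ 𝔼 (λ e → average (λ w → weight e * real (edgeCost I (f ∘ lookup w) e)))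
            ≈⟨ *-congˡ (∑-average 𝔼 (λ e w → weight e * real (edgeCost I (f ∘ lookup w) e))) ⟩
          ρ * average (λ w → realCost I (f ∘ lookup w))
            ≈⟨ *-congˡ (≈-trans (average-cong moved-cost) (average-const _)) ⟩
          ρ * realCost I f ∎

      solution-finite : IsFinite (lpValue blowUp solution)
      solution-finite = lpValue-finite blowUp solution λ k → noInfiniteMass (proj₂ (List.lookup edges′ k))

      solution-value : real (lpValue blowUp solution) ≤ realCost I f
      solution-value = begin
        real (lpValue blowUp solution)
          ≈⟨ real-lpValue blowUp solution (λ k → noInfiniteMass (proj₂ (List.lookup edges′ k))) ⟩
        lpReal blowUp (λ k → y (proj₂ (List.lookup edges′ k)))
          ≈⟨ ∑-edges′ (λ _ e → (weight e * ρ) * ∑ (words q (arity e)) (λ α → y e α * real (value (Ψ e α)))) ⟩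
        ∑ slots (λ _ → ∑ 𝔼 (λ e → (weight e * ρ) * ∑ (words q (arity e)) (λ α → y e α * real (value (Ψ e α)))))
          ≈⟨ ∑-cong slots (λ _ → copy-value) ⟩
        ∑ slots (λ _ → ρ * c)
          ≈⟨ ∑-collect unique? 𝕊 (λ _ → ρ * c) ⟩
        ∑ 𝕊 (λ s → [ unique? s ] * (ρ * c))
          -- Each copy costs ρ c, and there are at most n^N of them; the non-injective choices only
          -- reduce the LP value.
          ≤⟨ ∑-mono 𝕊 (λ s → *-monoˡ-≤ (*-nonNeg (proj₁ 0<ρ) (realCost-nonNeg I f)) ([]-≤1 (unique? s))) ⟩
        ∑ 𝕊 (λ s → 1# * (ρ * c))
          ≈⟨ ∑-*ʳ 𝕊 (ρ * c) (λ _ → 1#) ⟩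
        ∑ 𝕊 (λ _ → 1#) * (ρ * c)
          ≈⟨ solve 3 (λ s p c → s :* (p :* c) := (p :* s) :* c) ≈-refl (∑ 𝕊 (λ _ → 1#)) ρ c ⟩
        (ρ * ∑ 𝕊 (λ _ → 1#)) * c
          ≈⟨ ≈-trans (*-congʳ (uniform-total nr≈1 N)) (*-identityˡ c) ⟩
        c ∎
        where c = realCost I f

    -- Total weight times the bound of `expected-penalty`: for each of N vertices, at most qN rare
    -- positions in its row and at most N collisions.
    error : Carrier
    error = totalWeight I * ((N · 1#) * (r * ((q · 1#) * (N · 1#) + N · 1#)))

    -- Labels used fewer than N times in a row are replaced by a label that is
    -- used at least N times.  Every labeling in the support of the resulting
    -- product distribution then occurs on some copy of I inside blowUp, so that
    -- finiteness of the cost of ℓ′ carries over.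

    module LabelFrequencies (large : (q · 1#) * (N · 1#) < n · 1#)
                            (ℓ′ : Labeling blowUp) (cost-finite : IsFinite (costOf blowUp (proj₁ ℓ′))) where

      private
        row : Vertex → Fin n → Label
        row u i = lookup (proj₁ ℓ′) (combine u i)

        row∈list : ∀ u i → row u i ∈ list u
        row∈list u i = ≡.subst (λ v → row u i ∈ list v) (base-combine u i) (proj₂ ℓ′ (combine u i))

        default : Vertex → Fin n
        default u = proj₁ (exists-common N (row u) large)

        -- Positions are redirected rather than labels, so a repaired label still occurs in its row
        -- and hence lies in the candidate list.
        repaired : Vertex → Fin n → Fin n
        repaired u i = if does (common? N (row u) (row u i)) then i else default u

        repaired-common : ∀ u i → Common N (row u) (row u (repaired u i))
        repaired-common u i with common? N (row u) (row u i)
        ... | yes c = c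
        ... | no _  = proj₂ (exists-common N (row u) large)

        repaired-id : ∀ u i → Common N (row u) (row u i) → repaired u i ≡ i
        repaired-id u i c with common? N (row u) (row u i)
        ... | yes _ = refl
        ... | no ¬c = ⊥-elim (¬c c)

        m m″ : Vertex → Fin n → Label
        m v i  = row (rep v) i
        m″ v i = row (rep v) (repaired (rep v) i)

        x : Vertex → Label → Carrier
        x v a = r * ∑ (allFin n) (λ i → [ a Fin.≟ m″ v i ])

        x-zero : ∀ v a → (∀ i → a ≢ m″ v i) → x v a ≈ 0#
        x-zero v a a≢ = ≈-trans (*-congˡ (∑-zero (allFin n) λ i → []-no (a Fin.≟ m″ v i) (a≢ i))) (zeroʳ r)

        x-sum : ∀ v → sumFin (x v) ≈ 1#
        x-sum v = begin-equality
          sumFin (x v)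
            ≈⟨ sumFin≈∑ q (x v) ⟩
          ∑ (allFin q) (λ a → r * ∑ (allFin n) (λ i → [ a Fin.≟ m″ v i ]))
            ≈⟨ ∑-*ˡ (allFin q) r _ ⟩
          r * ∑ (allFin q) (λ a → ∑ (allFin n) (λ i → [ a Fin.≟ m″ v i ]))
            ≈⟨ *-congˡ (∑-swap (allFin q) (allFin n) _) ⟩
          r * ∑ (allFin n) (λ i → ∑ (allFin q) (λ a → [ a Fin.≟ m″ v i ]))
            ≈⟨ *-congˡ (∑-cong (allFin n) λ i → ≈-trans
                 (∑-cong (allFin q) λ a → ≈-sym (*-identityʳ _)) (∑-δ (m″ v i) (λ _ → 1#))) ⟩
          r * ∑ (allFin n) (λ _ → 1#)
            ≈⟨ *-congˡ (≈-trans (∑-const n 1#) (*-identityʳ _)) ⟩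
          r * (n · 1#)
            ≈⟨ ≈-trans (*-comm r _) nr≈1 ⟩
          1# ∎

      fractional : FractionalSolution I
      fractional = record
        { x      = x
        ; x≥0    = λ v a → *-nonNeg (proj₁ 0<r) (∑-nonNeg (allFin n) λ i → []-nonNeg (a Fin.≟ m″ v i))
        ; x-sum  = x-sum
        ; x-list = λ v a a∉ → x-zero v a λ where
            i refl → a∉ (≡.subst (m″ v i ∈_) (list-∼ (∼-rep v)) (row∈list (rep v) _))
        }

      fractional-symmetric : IsSymmetricSolution I G fractional
      fractional-symmetric σ σ∈ v a = ≈-reflexive (≡.cong
        (λ u → r * ∑ (allFin n) (λ i → [ a Fin.≟ row u (repaired u i) ]))
        (≡.sym (rep-cong (σ , σ∈ , refl))))

      private
        -- An injective choice is one of the copies of I, and all weights are positive, so a finite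
        -- total cost excludes infinite terms.
        copies-finite : ∀ s → Unique s → EdgesFinite I (λ v → m v (lookup s v))
        copies-finite s unique e with ∈-collect unique? (∈-words s) unique
        ... | unique′ , s∈ = ≡.subst (λ α → IsFinite (value (Ψ e α)))
          (≡.sym (Vec.map-∘ (lookup (proj₁ ℓ′)) (place (s , unique′)) (vertices e)))
          (≡.subst (λ (s , e) → IsFinite (value (Ψ e (Vec.map (lookup (proj₁ ℓ′)) (Vec.map (place s) (vertices e))))))
            (≡.sym (Any.lookup-index position))
            (costOf-finite⁻ blowUp (proj₁ ℓ′) cost-finite (index position)))
          where
          position : ((s , unique′) , e) List.∈ edges′
          position = ∈.∈-concatMap⁺ _ (List.lose s∈ (∈.∈-map⁺ ((s , unique′) ,_) (∈.∈-allFin e)))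

        -- A labeling in the support uses common labels only, so `choose-distinct` reads it off the
        -- original rows along an injective choice.
        support : ∀ ℓ → probability I fractional ℓ ≈ 0# ⊎ EdgesFinite I (lookup ℓ)
        support ℓ with Fin.all? (λ v → Fin.any? (λ i → lookup ℓ v Fin.≟ m″ v i))
        ... | no ¬p with Fin.¬∀⟶∃¬ N _ (λ v → Fin.any? (λ i → lookup ℓ v Fin.≟ m″ v i)) ¬p
        ...   | v , ¬i = inj₁ (product-zero _ v (x-zero v (lookup ℓ v) λ i eq → ¬i (i , eq)))
        support ℓ | yes p with choose-distinct N N ℕ.≤-refl m (lookup ℓ) (λ v → let i , eq = p v in
                          ≡.subst (Common N (m v)) (≡.sym eq) (repaired-common (rep v) i))
        ...   | s , unique , ℓ≡ = inj₂ (edgesFinite-cong I (λ v → ≡.sym (ℓ≡ v)) (copies-finite s unique))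

        rare? : ∀ v i → Dec (¬ Common N (m v) (m v i))
        rare? v i = ¬? (common? N (m v) (m v i))

        b : Vec (Fin n) N → Carrier
        b = penalty λ v i → [ rare? v i ]

        b-nonNeg : ∀ s → 0# ≤ b s
        b-nonNeg = penalty-nonNeg _ λ v i → []-nonNeg (rare? v i)

        W = totalWeight I

        copyCost : Vec (Fin n) N → Carrier
        copyCost s = realCost I (λ v → m v (lookup s v))

        -- The repaired and the original rows are compared at the same positions: they agree along a
        -- good choice, and for any other the penalty is at least 1 and pays for the whole weight.
        sample-bound : ∀ s → realCost I (λ v → m″ v (lookup s v)) ≤ [ unique? s ] * copyCost s + W * b s
        sample-bound s with good-or-penalised rare? s
        ... | inj₂ 1≤b = begin
          realCost I (λ v → m″ v (lookup s v))     ≤⟨ realCost≤totalWeight I _ ⟩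
          W                                        ≈⟨ *-identityʳ W ⟨
          W * 1#                                   ≤⟨ *-monoʳ-≤ (totalWeight-nonNeg I) 1≤b ⟩
          W * b s                                  ≤⟨ x≤y+x (*-nonNeg ([]-nonNeg (unique? s)) (realCost-nonNeg I _)) ⟩
          [ unique? s ] * copyCost s + W * b s         ∎
        ... | inj₁ (unique , good) = begin
          realCost I (λ v → m″ v (lookup s v))     ≈⟨ realCost-cong I (λ v → ≡.cong (row (rep v))
                                                        (repaired-id (rep v) _ (common v))) ⟩
          copyCost s                                   ≈⟨ *-identityˡ _ ⟨
          1# * copyCost s                              ≈⟨ *-congʳ ([]-yes (unique? s) unique) ⟨
          [ unique? s ] * copyCost s                   ≤⟨ x≤x+y (*-nonNeg (totalWeight-nonNeg I) (b-nonNeg s)) ⟩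
          [ unique? s ] * copyCost s + W * b s         ∎
          where
          common : ∀ v → Common N (m v) (m v (lookup s v))
          common v with common? N (m v) (m v (lookup s v))
          ... | yes c = c
          ... | no ¬c = ⊥-elim (good v ¬c)

        cost′ : ρ * ∑ 𝕊 (λ s → [ unique? s ] * copyCost s) ≈ realCost blowUp (lookup (proj₁ ℓ′))
        cost′ = ≈-sym (begin-equality
          realCost blowUp (lookup (proj₁ ℓ′))
            ≈⟨ ∑-edges′ (λ s e → (weight e * ρ) *
                 real (value (Ψ e (Vec.map (lookup (proj₁ ℓ′)) (Vec.map (place s) (vertices e)))))) ⟩
          ∑ slots (λ s → ∑ 𝔼 (λ e → (weight e * ρ) *
                 real (value (Ψ e (Vec.map (lookup (proj₁ ℓ′)) (Vec.map (place s) (vertices e)))))))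
            ≈⟨ ∑-cong slots (λ s → ≈-trans
                 (∑-cong 𝔼 λ e → ≈-trans
                   (*-cong (*-comm _ ρ) (≈-reflexive (≡.cong (real ∘ value ∘ Ψ e)
                     (≡.sym (Vec.map-∘ (lookup (proj₁ ℓ′)) (place s) (vertices e))))))
                   (*-assoc ρ _ _))
                 (∑-*ˡ 𝔼 ρ _)) ⟩
          ∑ slots (λ (s , _) → ρ * copyCost s)
            ≈⟨ ∑-*ˡ slots ρ _ ⟩
          ρ * ∑ slots (λ (s , _) → copyCost s)
            ≈⟨ *-congˡ (∑-collect unique? 𝕊 copyCost) ⟩
          ρ * ∑ 𝕊 (λ s → [ unique? s ] * copyCost s) ∎)

      fractional-finite : IsFinite (multilinearValue I fractional)
      fractional-finite = proj₁ (real-multilinear I fractional support)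

      fractional-value : real (multilinearValue I fractional) ≤ real (costOf blowUp (proj₁ ℓ′)) + error
      fractional-value = begin
        real (multilinearValue I fractional)
          ≈⟨ proj₂ (real-multilinear I fractional support) ⟩
        ∑ (words q N) (λ ℓ → probability I fractional ℓ * realCost I (lookup ℓ))
          ≈⟨ ∑-product r N m″ x (λ v a → ≈-refl) (λ ℓ → realCost I (lookup ℓ)) ⟩
        ρ * ∑ 𝕊 (λ s → realCost I (lookup (Vec.tabulate (λ v → m″ v (lookup s v)))))
          ≈⟨ *-congˡ (∑-cong 𝕊 λ s → realCost-cong I (Vec.lookup∘tabulate _)) ⟩
        ρ * ∑ 𝕊 (λ s → realCost I (λ v → m″ v (lookup s v)))
          ≤⟨ *-monoʳ-≤ (proj₁ 0<ρ) (∑-mono 𝕊 sample-bound) ⟩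
        ρ * ∑ 𝕊 (λ s → [ unique? s ] * copyCost s + W * b s)
          ≈⟨ *-congˡ (≈-trans (∑-+ 𝕊 _ _) (+-congˡ (∑-*ˡ 𝕊 W b))) ⟩
        ρ * (∑ 𝕊 (λ s → [ unique? s ] * copyCost s) + W * ∑ 𝕊 b)
          ≈⟨ solve 4 (λ p c w b → p :* (c :+ w :* b) := p :* c :+ w :* (p :* b)) ≈-refl
               ρ (∑ 𝕊 (λ s → [ unique? s ] * copyCost s)) W (∑ 𝕊 b) ⟩
        ρ * ∑ 𝕊 (λ s → [ unique? s ] * copyCost s) + W * (ρ * ∑ 𝕊 b)
          ≤⟨ +-mono-≤ (≤-reflexive cost′) (*-monoʳ-≤ (totalWeight-nonNeg I)
               (expected-penalty nr≈1 (proj₁ 0<r) N ℕ.≤-refl _ (λ v → count-rare N (m v)))) ⟩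
        realCost blowUp (lookup (proj₁ ℓ′)) + error
          ≈⟨ +-congʳ (real-costOf blowUp (proj₁ ℓ′) (costOf-finite⁻ blowUp (proj₁ ℓ′) cost-finite)) ⟨
        real (costOf blowUp (proj₁ ℓ′)) + error ∎

-- Choice of parameters and comparison of the ratios

module IntegralityGaps (R : Reals) (q : ℕ) where
  open OrderedField R
  open MinCSP R q
  open ExtendedProperties R
  open BasicLP R q
  open CostProperties R q
  open Sampling R
  open BlowUp R q
  open ≤-Reasoning

  large-reciprocal : ∀ X → ∃[ n ] ∃[ r ] X < n · 1# × (n · 1#) * r ≈ 1# × 0# < r
  large-reciprocal X =
    let n , X≤n        = archimedean X
        r , nr≈1 , 0<r = inverse⁺ {suc n · 1#} (≤-<-trans {0#} {n · 1#} {suc n · 1#} (·-nonNeg n) (n<1+n n))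
    -- The successor makes the inequality strict and the number invertible.
    in suc n , r , ≤-<-trans {X} {n · 1#} {suc n · 1#} X≤n (n<1+n n) , nr≈1 , 0<r

  +-cancelʳ-≤ : ∀ {x y} z → x + z ≤ y + z → x ≤ y
  +-cancelʳ-≤ {x} {y} z x+z≤y+z = begin
    x              ≈⟨ cancel x ⟨
    (x + z) - z    ≤⟨ +-monoˡ-≤ (- z) x+z≤y+z ⟩
    (y + z) - z    ≈⟨ cancel y ⟩
    y              ∎
    where
    cancel : ∀ t → (t + z) - z ≈ t
    cancel t = ≈-trans (+-assoc t z (- z)) (≈-trans (+-congˡ (-‿inverseʳ z)) (+-identityʳ t))

  -- The witness is εs/(1 + ε): its factor is below both ε and 1, also when ε ≥ 1.
  slack : ∀ {ε s} → 0# < ε → 0# < s → ∃[ τ ] 0# < τ × τ ≤ ε * s × τ < s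
  slack {ε} {s} 0<ε 0<s =
    let k , [1+ε]k≈1 , 0<k = inverse⁺ {1# + ε} (<-≤-trans {0#} {1#} {1# + ε} 0<1 (x≤x+y (proj₁ 0<ε)))
    in (ε * k) * s , *-pos (*-pos 0<ε 0<k) 0<s , bounds k 0<k
         (≈-trans (≈-sym (≈-trans (distribʳ k 1# ε) (+-congʳ (*-identityˡ k)))) [1+ε]k≈1)
    where
    bounds : ∀ k → 0# < k → k + ε * k ≈ 1# → (ε * k) * s ≤ ε * s × (ε * k) * s < s
    bounds k 0<k k+εk≈1 =
      *-monoˡ-≤ (proj₁ 0<s) (begin
        ε * k    ≤⟨ *-monoʳ-≤ (proj₁ 0<ε) (≤-respʳ k+εk≈1 (x≤x+y (*-nonNeg (proj₁ 0<ε) (proj₁ 0<k)))) ⟩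
        ε * 1#   ≈⟨ *-identityʳ ε ⟩
        ε        ∎) ,
      ≰⇒< λ s≤τ → <⇒≰ (*-pos 0<k 0<s) (+-cancelʳ-≤ ((ε * k) * s) (begin
        k * s + (ε * k) * s    ≈⟨ distribʳ s k (ε * k) ⟨
        (k + ε * k) * s        ≈⟨ *-congʳ k+εk≈1 ⟩
        1# * s                 ≈⟨ *-identityˡ s ⟩
        s                      ≤⟨ s≤τ ⟩
        (ε * k) * s            ≈⟨ +-identityˡ ((ε * k) * s) ⟨
        0# + (ε * k) * s       ∎))

  module _ {Φ : CostFamily} (I : Instance Φ) (G : PermutationGroup (Instance.vertexCount I))
           (sym : IsSymmetricInstance I G) (S : Ext) (b : Carrier)
           (S≤ : ∀ (s : Σ (FractionalSolution I) (IsSymmetricSolution I G)) →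
                 S ≤∞ multilinearValue I (proj₁ s)) where
    open Instance I

    record ApproximateGap (τ : Carrier) : Set where
      field
        I′      : Instance Φ
        opt     : Ext
        lp      : Carrier
        opt-min : IsMinimum {Labeling I′} (λ ℓ → costOf I′ (proj₁ ℓ)) opt
        lp-min  : IsMinimum (lpValue I′) (fin lp)
        0≤lp    : 0# ≤ lp
        lp≤b    : lp ≤ b
        -- A finite optimum of `I′` forces S to be finite; an infinite one imposes nothing on S.
        S≤opt+τ : ∀ {o} → opt ≡ fin o → ∃[ S₀ ] S ≡ fin S₀ × S₀ ≤ o + τ

    private
      N  = vertexCount · 1#
      qN = (q · 1#) * N
      K  = totalWeight I * (N * (qN + N))

      0≤qN : 0# ≤ qN
      0≤qN = *-nonNeg (·-nonNeg q) (·-nonNeg vertexCount)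

      0≤K : 0# ≤ K
      0≤K = *-nonNeg (totalWeight-nonNeg I)
        (*-nonNeg (·-nonNeg vertexCount) (+-nonNeg 0≤qN (·-nonNeg vertexCount)))

    module _ (τ t : Carrier) (0<τ : 0# < τ) (τt≈1 : τ * t ≈ 1#) (0<t : 0# < t)
             (n : ℕ) (r : Carrier) (X<n : qN + K * t < n · 1#)
             (nr≈1 : (n · 1#) * r ≈ 1#) (0<r : 0# < r)
             (f : Vertex → Label) (f∈list : ∀ v → f v ∈ list v)
             (f-finite : EdgesFinite I f) (f≤b : realCost I f ≤ b) where

      private
        J = blowUp I G sym n r nr≈1 0<r
        module U = AveragedLabeling I G sym n r nr≈1 0<r f f∈list f-finite

        large : qN < n · 1#
        large = ≤-<-trans {qN} {qN + K * t} {n · 1#} (x≤x+y (*-nonNeg 0≤K (proj₁ 0<t))) X<n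

        error≤τ : error I G sym n r nr≈1 0<r ≤ τ
        error≤τ = begin
          error I G sym n r nr≈1 0<r
            ≈⟨ solve 4 (λ w n r x → w :* (n :* (r :* x)) := (w :* (n :* x)) :* r) ≈-refl
                 (totalWeight I) N r (qN + N) ⟩
          K * r
            ≈⟨ ≈-trans (*-congˡ (*-congʳ τt≈1)) (*-congˡ (*-identityˡ r)) ⟨
          K * ((τ * t) * r)
            ≈⟨ solve 4 (λ k a t r → k :* ((a :* t) :* r) := a :* ((k :* t) :* r)) ≈-refl K τ t r ⟩
          τ * ((K * t) * r)
            ≤⟨ *-monoʳ-≤ (proj₁ 0<τ) (*-monoˡ-≤ (proj₁ 0<r) (≤-trans (x≤y+x 0≤qN) (proj₁ X<n))) ⟩
          τ * ((n · 1#) * r)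
            ≈⟨ ≈-trans (*-congˡ nr≈1) (*-identityʳ τ) ⟩
          τ ∎

        opt-exists = labeling-minimum J
          ( Vec.tabulate (f ∘ base I G sym n r nr≈1 0<r)
          , λ u → ≡.subst (_∈ Instance.list J u) (≡.sym (Vec.lookup∘tabulate _ u)) (f∈list _) )

        lp-exists = lp-minimum J U.solution U.solution-finite

        lp≤ : ∀ {l} → IsMinimum (lpValue J) (fin l) → l ≤ b
        lp≤ {l} (_ , minimal) = ≤-trans (≤-trans
          (fin≤∞⁻ (≡.subst (fin l ≤∞_) (fin-real U.solution-finite) (minimal U.solution)))
          U.solution-value) f≤b

        below-finite : ∀ {x y} → x ≤∞ y → IsFinite y → ∃[ x₀ ] x ≡ fin x₀ × x₀ ≤ real y
        below-finite (fin x≤y) (fin _) = _ , refl , x≤y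

        S≤opt : ∀ {opt o} → IsMinimum {Labeling J} (λ ℓ → costOf J (proj₁ ℓ)) opt → opt ≡ fin o →
                ∃[ S₀ ] S ≡ fin S₀ × S₀ ≤ o + τ
        S≤opt {o = o} ((ℓ , ℓ≈o) , _) refl =
          let cost-finite , cost≈o = ≈∞⇒finite ℓ≈o
              module L = LabelFrequencies I G sym n r nr≈1 0<r large ℓ cost-finite
              S₀ , S≡ , S₀≤ = below-finite (S≤ (L.fractional , L.fractional-symmetric)) L.fractional-finite
          in S₀ , S≡ , ≤-trans S₀≤ (≤-trans L.fractional-value
               (+-mono-≤ (≤-reflexive cost≈o) error≤τ))

      blow-up-gap : ApproximateGap τ
      blow-up-gap = record
        { I′      = J
        ; opt     = proj₁ opt-exists
        ; lp      = proj₁ lp-exists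
        ; opt-min = proj₂ opt-exists
        ; lp-min  = proj₁ (proj₂ lp-exists)
        ; 0≤lp    = proj₂ (proj₂ lp-exists)
        ; lp≤b    = lp≤ (proj₁ (proj₂ lp-exists))
        ; S≤opt+τ = S≤opt (proj₂ opt-exists)
        }

    approximate-gap : ∀ s → multilinearValue I s ≈∞ fin b → ∀ {τ} → 0# < τ → ApproximateGap τ
    approximate-gap s s≈b {τ} 0<τ =
      let t , τt≈1 , 0<t                 = inverse⁺ 0<τ
          -- The summand `qN` ensures a common label in every row, and `K * t`, which is K/τ, brings
          -- the error K/n down to τ.
          n , r , X<n , nr≈1 , 0<r       = large-reciprocal (qN + K * t)
          f , f∈list , f-finite , f≤b    = cheap-labeling I s s≈b
      in blow-up-gap τ t 0<τ τt≈1 0<t n r X<n nr≈1 0<r f f∈list f-finite f≤b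

  -- For finite values, opt ≥ S - τ ≥ (1 - ε) S and l ≤ b give opt/l ≥ (1 - ε) S/b; the cases with ∞
  -- or l = 0 have ratio ∞.
  ratio-exists : ∀ {S b γ opt l τ ε} → IsRatio S (fin b) γ → 0# ≤ l → l ≤ b → 0# < τ →
                 (∀ {S₀} → S ≡ fin S₀ → τ ≤ ε * S₀ × τ < S₀) →
                 (∀ {o} → opt ≡ fin o → ∃[ S₀ ] S ≡ fin S₀ × S₀ ≤ o + τ) →
                 ∃[ ρ ] IsRatio opt (fin l) ρ × ((1# - ε) ⊙ γ) ≤∞ ρ
  ratio-exists {opt = ∞} _ _ _ _ _ _ = ∞ , ∞/finite , top
  ratio-exists {b = b} {γ} {fin o} {l} {τ} {ε} ratio 0≤l l≤b 0<τ τ-small S≤o+τ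
    with S≤o+τ refl
  ... | S₀ , refl , S₀≤o+τ = compare (l ≤? 0#) ratio
    where
    τ≤εS₀ = proj₁ (τ-small refl)
    τ<S₀  = proj₂ (τ-small refl)

    -- Otherwise S₀ ≤ τ, against the choice of τ. Positivity excludes the undefined ratio 0/0.
    0<o : 0# < o
    0<o = ≰⇒< λ o≤0 → <⇒≰ τ<S₀ (≤-trans S₀≤o+τ (≤-respʳ (+-identityˡ τ) (+-monoˡ-≤ τ o≤0)))

    [1-ε]S₀≤o : (1# - ε) * S₀ ≤ o
    [1-ε]S₀≤o = +-cancelʳ-≤ (ε * S₀) (begin
      (1# - ε) * S₀ + ε * S₀   ≈⟨ distribʳ S₀ (1# - ε) ε ⟨
      ((1# - ε) + ε) * S₀      ≈⟨ *-congʳ (≈-trans (+-comm (1# - ε) ε) (x+[y-x]≈y ε 1#)) ⟩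
      1# * S₀                  ≈⟨ *-identityˡ S₀ ⟩
      S₀                       ≤⟨ S₀≤o+τ ⟩
      o + τ                    ≤⟨ +-mono-≤ ≤-refl τ≤εS₀ ⟩
      o + ε * S₀               ∎)

    g-nonNeg : ∀ {g} → 0# < b → g * b ≈ S₀ → 0# ≤ g
    g-nonNeg {g} 0<b gb≈S₀ = *-cancelˡ-≤ 0<b (≤-respˡ (≈-sym (zeroʳ b)) (≤-respʳ
      (≈-trans (≈-sym gb≈S₀) (*-comm g b)) (≤-trans (proj₁ 0<τ) (proj₁ τ<S₀))))

    scaled : ∀ {g} → 0# < b → g * b ≈ S₀ → l * ((1# - ε) * g) ≤ o
    -- Scaling l ≤ b needs a nonnegative factor; for ε > 1 the left side is at most 0 < o.
    scaled {g} 0<b gb≈S₀ with total 0# (1# - ε)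
    ... | inj₁ 0≤1-ε = begin
      l * ((1# - ε) * g)    ≤⟨ *-monoˡ-≤ (*-nonNeg 0≤1-ε (g-nonNeg 0<b gb≈S₀)) l≤b ⟩
      b * ((1# - ε) * g)    ≈⟨ solve 3 (λ b e g → b :* (e :* g) := e :* (g :* b)) ≈-refl b (1# - ε) g ⟩
      (1# - ε) * (g * b)    ≈⟨ *-congˡ gb≈S₀ ⟩
      (1# - ε) * S₀         ≤⟨ [1-ε]S₀≤o ⟩
      o                     ∎
    ... | inj₂ 1-ε≤0 = begin
      l * ((1# - ε) * g)    ≤⟨ *-monoʳ-≤ 0≤l (*-monoˡ-≤ (g-nonNeg 0<b gb≈S₀) 1-ε≤0) ⟩
      l * (0# * g)          ≈⟨ ≈-trans (*-congˡ (zeroˡ g)) (zeroʳ l) ⟩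
      0#                    ≤⟨ proj₁ 0<o ⟩
      o                     ∎

    compare : ∀ {γ} → Dec (l ≤ 0#) → IsRatio (fin S₀) (fin b) γ →
              ∃[ ρ ] IsRatio (fin o) (fin l) ρ × ((1# - ε) ⊙ γ) ≤∞ ρ
    compare (yes l≤0) _ = ∞ , positive/0 0<o (antisym l≤0 0≤l) , top
    compare (no l≰0) (positive/0 _ b≈0) = ⊥-elim (l≰0 (≤-respʳ b≈0 l≤b))
    compare (no l≰0) (finite {γ = g} 0<b gb≈S₀) =
      let 0<l = ≰⇒< l≰0
          k , lk≈1 , _ = inverse⁺ 0<l
      in fin (o * k)
       , finite 0<l (≈-trans (*-assoc o k l) (≈-trans (*-congˡ (≈-trans (*-comm k l) lk≈1)) (*-identityʳ o)))
       , fin (*-cancelˡ-≤ 0<l (begin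
           l * ((1# - ε) * g)   ≤⟨ scaled 0<b gb≈S₀ ⟩
           o                    ≈⟨ ≈-trans (*-congˡ lk≈1) (*-identityʳ o) ⟨
           o * (l * k)          ≈⟨ solve 3 (λ o l k → o :* (l :* k) := l :* (o :* k)) ≈-refl o l k ⟩
           l * (o * k)          ∎))

  -- A symmetric optimum S₀ is positive because S₀ ≥ b.
  tolerance : ∀ {S b γ ε} → IsRatio S (fin b) γ → fin b ≤∞ S → 0# < ε →
              ∃[ τ ] 0# < τ × (∀ {S₀} → S ≡ fin S₀ → τ ≤ ε * S₀ × τ < S₀)
  tolerance (finite 0<b _) (fin b≤S) 0<ε =
    let τ , 0<τ , τ≤ , τ< = slack 0<ε (<-≤-trans 0<b b≤S) in τ , 0<τ , λ { refl → τ≤ , τ< }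
  tolerance (positive/0 0<S _) _ 0<ε =
    let τ , 0<τ , τ≤ , τ< = slack 0<ε 0<S in τ , 0<τ , λ { refl → τ≤ , τ< }
  -- For infinite S the smallness condition is vacuous, and any positive τ will do.
  tolerance ∞/finite _ _ = 1# , 0<1 , λ ()

  ≤∞-resp-≈∞ : ∀ {x y z} → x ≤∞ y → y ≈∞ z → x ≤∞ z
  ≤∞-resp-≈∞ (fin x≤y) (fin y≈z) = fin (≤-respʳ y≈z x≤y)
  ≤∞-resp-≈∞ top       top       = top

  symmetry⇒integrality : ∀ {Φ} (I : Instance Φ) (G : PermutationGroup (Instance.vertexCount I)) →
    IsSymmetricInstance I G → ∀ {S b γ ε} →
    IsMinimum {Σ (FractionalSolution I) (IsSymmetricSolution I G)} (λ s → multilinearValue I (proj₁ s)) S →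
    IsMinimum (multilinearValue I) (fin b) →
    IsRatio S (fin b) γ → 0# < ε →
    Σ (Instance Φ) λ I′ → Σ Ext λ ρ → IntegralityGap I′ ρ × ((1# - ε) ⊙ γ) ≤∞ ρ
  symmetry⇒integrality I G sym {S} {b} ((s , s≈S) , S≤) ((t , t≈b) , b≤) ratio 0<ε =
    -- The symmetric minimiser is a fractional solution, hence b ≤ S.
    let τ , 0<τ , τ-small = tolerance ratio (≤∞-resp-≈∞ (b≤ (proj₁ s)) s≈S) 0<ε
        module A = ApproximateGap (approximate-gap I G sym S b S≤ t t≈b 0<τ)
        ρ , ratio′ , bound = ratio-exists ratio A.0≤lp A.lp≤b 0<τ τ-small A.S≤opt+τ
    in A.I′ , ρ , (A.opt , fin A.lp , A.opt-min , A.lp-min , ratio′) , bound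

theorem8 : (R : Reals) (q : ℕ) → let open Reals R in let open MinCSP R q in
    (Φ : CostFamily) (I : Instance Φ)
    (G : PermutationGroup (Instance.vertexCount I)) →
    IsSymmetricInstance I G →
    (γ : Ext) → SymmetryGap I G γ →
    (ε : Carrier) → 0# < ε →
    Σ (Instance Φ) λ I′ → Σ Ext λ ρ →
    IntegralityGap I′ ρ × ((1# - ε) ⊙ γ) ≤∞ ρ
theorem8 R q Φ I G sym γ (S , opt , S-min , opt-min , ratio) ε 0<ε = by-ratio ratio opt-min
  where
  open IntegralityGaps R q
  open MinCSP R q
  open Reals R
  -- A defined ratio has a finite denominator, so matching on it exposes `opt` as a real number.
  by-ratio : ∀ {opt} → IsRatio S opt γ → IsMinimum (multilinearValue I) opt →
             Σ (Instance Φ) λ I′ → Σ Ext λ ρ → IntegralityGap I′ ρ × ((1# - ε) ⊙ γ) ≤∞ ρ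
  by-ratio ratio@(finite _ _)     opt-min = symmetry⇒integrality I G sym S-min opt-min ratio 0<ε
  by-ratio ratio@(positive/0 _ _) opt-min = symmetry⇒integrality I G sym S-min opt-min ratio 0<ε
  by-ratio ratio@∞/finite         opt-min = symmetry⇒integrality I G sym S-min opt-min ratio 0<ε
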